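{- There exist constants $c>0$ and $n_0$ such that for all $n\geq n_0$, the number of graphs on vertex set $[n]$ that have an even number of edges but have no even decomposition is at most $2^{\binom n2}\exp(-c\sqrt{\log n})$.
   Context: $\log$ is the natural logarithm. An even decomposition of a graph $H$ is a sequence of vertex sets $V(H)=V_0\supset V_1\supset\cdots\supset V_k=\emptyset$ such that for every $i\in[k]$, the set $V_{i-1}\setminus V_i$ is independent in $H$ and the number of edges of $H$ between $V_{i-1}\setminus V_i$ and $V_i$ is even. -}

module Defs where

open import Data.Bool using (Bool; true; false; _∧_)
open import Data.Nat using (ℕ; _*_; _^_; _≤_; _<ᵇ_)
open import Data.Nat.Divisibility using (_∣_)
open import Data.Nat.Combinatorics using (_C_)
open import Data.Fin using (Fin; toℕ)
open import Data.Fin.Subset using (Subset; _∈_; _⊂_; _─_; ⊤; ⊥)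
open import Data.List using (List; []; _∷_; allFin; concatMap; map; length; filterᵇ)
open import Data.Product using (_×_; _,_)
open import Data.Vec using (Vec; lookup)
open import Relation.Binary.PropositionalEquality using (_≡_)
open import Relation.Nullary using (¬_)

Graph : ℕ → Set
Graph n = Vec (Vec Bool n) n

adjᵇ : ∀ {n} → Graph n → Fin n → Fin n → Bool
adjᵇ A i j = lookup (lookup A i) j

IsSimple : ∀ {n} → Graph n → Set
IsSimple {n} A = ((i j : Fin n) → adjᵇ A i j ≡ adjᵇ A j i) × ((i : Fin n) → adjᵇ A i i ≡ false)

allPairs : (n : ℕ) → List (Fin n × Fin n)
allPairs n = concatMap (λ i → map (λ j → (i , j)) (allFin n)) (allFin n)

edgeCount : ∀ {n} → Graph n → ℕ
edgeCount {n} A = length (filterᵇ (λ { (i , j) → (toℕ i <ᵇ toℕ j) ∧ adjᵇ A i j }) (allPairs n))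

-- number of edges of H between two (disjoint) vertex sets S and T
edgesBetween : ∀ {n} → Graph n → Subset n → Subset n → ℕ
edgesBetween {n} A S T =
  length (filterᵇ (λ { (x , y) → lookup S x ∧ (lookup T y ∧ adjᵇ A x y) }) (allPairs n))

Even : ℕ → Set
Even k = 2 ∣ k

Independent : ∀ {n} → Graph n → Subset n → Set
Independent {n} A S = (x y : Fin n) → x ∈ S → y ∈ S → adjᵇ A x y ≡ false

data EvenDecFrom {n : ℕ} (A : Graph n) : Subset n → Set where
  done : EvenDecFrom A ⊥
  step : ∀ {V} (W : Subset n) → W ⊂ V → Independent A (V ─ W) →
         Even (edgesBetween A (V ─ W) W) → EvenDecFrom A W → EvenDecFrom A V

HasEvenDecomposition : ∀ {n} → Graph n → Set
HasEvenDecomposition A = EvenDecFrom A ⊤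

Bad : ∀ {n} → Graph n → Set
Bad A = IsSimple A × Even (edgeCount A) × ¬ HasEvenDecomposition A

-- WithinBound n m p q  ⇔  m ≤ 2^(n C 2) · 2^(-(p/q)·√(log₂ n))   (exactly, for n ≥ 1, q ≥ 1).
-- Encoding: the inequality is m^q · 2^(p√(log₂ n)) ≤ 2^(q·C(n,2)); it holds iff
-- for every rational r = u/v with 0 ≤ r ≤ p√(log₂ n)  (⇔ 2^(u²) ≤ n^(p²v²))
-- we have 2^r · m^q ≤ 2^(q·C(n,2))  (⇔ 2^u · m^(qv) ≤ 2^(q·C(n,2)·v)).
WithinBound : ℕ → ℕ → ℕ → ℕ → Set
WithinBound n m p q =
  (u v : ℕ) → 2 ^ (u * u) ≤ n ^ (p * p * (v * v)) →
  2 ^ u * m ^ (q * v) ≤ 2 ^ (q * (n C 2) * v)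

{-# OPTIONS --safe #-}
-- Fix a set F of vertices and delete vertices outside F, either one vertex of even
-- degree or two non-adjacent vertices of odd degree.  This gets stuck only when the
-- surviving vertices outside F form a clique O of vertices of odd degree.  Which O
-- survives depends on the edges from a vertex outside F to F only through their
-- parity, so toggling the edges from c to q and to z (q, z ∈ F) for arbitrary c ∈ O
-- keeps O.  If q has even degree, deleting it makes a random part of O even, and
-- deleting even vertices of O then alternates the parities until the two classes
-- have cancelled; on average the clique shrinks by a factor 5/6 for every q used.
--
-- This is done twice.  First, for F = R ∪ S with a reservoir R of order log n; all
-- that survives of the rest is at most two vertices, except with probability
-- n (5/6)^|R|.  Then for F = S, where S is an independent set of order √(log n);
-- the clique outside S has at most |R| + 2 vertices, and at most two of them survive
-- except with probability (|R| + 2) (5/6)^|S|.  As the number of edges is even, none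
-- survives, and what is left of S is independent.  For S one takes the first
-- independent set among many disjoint blocks of vertices.
module Submission where

open import Defs
open import Data.Nat using (ℕ; _≤_)
open import Data.Product using (Σ; _×_)
open import Data.List using (List; length)
open import Data.List.Relation.Unary.All using (All)
open import Data.List.Relation.Unary.Unique.Propositional using (Unique)

open import Data.Bool using (Bool; true; false; _∧_; _∨_; not; _xor_; if_then_else_)
import Data.Bool.Properties as Boolₚ
open import Data.Bool.Solver using (module xor-∧-Solver)
open import Data.Empty using (⊥-elim)
open import Data.Fin using (Fin; zero; suc; toℕ; combine; inject≤; _↑ˡ_; _↑ʳ_; splitAt)
import Data.Fin.Properties as Finₚ
import Data.Fin.Subset as Sub
open import Data.List using ([]; _∷_; _++_; map; concatMap; filterᵇ; allFin; cartesianProduct)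
import Data.List as List
open import Data.List.Membership.Propositional using (_∈_)
open import Data.List.Membership.Propositional.Properties
open import Data.List.Properties using (length-++; length-map; length-tabulate)
open import Data.List.Relation.Unary.All using ([]; _∷_)
import Data.List.Relation.Unary.All as All
import Data.List.Relation.Unary.All.Properties as Allₚ
open import Data.List.Relation.Unary.AllPairs using ([]; _∷_)
open import Data.List.Relation.Unary.Any using (Any; here; there)
import Data.List.Relation.Unary.Any as Any
import Data.List.Relation.Unary.Unique.Propositional.Properties as Uniqueₚ
open import Data.Nat hiding (ℕ; _≤_)
open import Data.Nat.Combinatorics using (_C_; nCk+nC[k+1]≡[n+1]C[k+1]; nC1≡n)
open import Data.Nat.Divisibility using (divides)
open import Data.Nat.Properties
open import Algebra.Properties.CommutativeSemigroup +-commutativeSemigroup using () renaming (interchange to +-interchange)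
open import Algebra.Properties.CommutativeSemigroup *-commutativeSemigroup using () renaming (interchange to *-interchange; x∙yz≈y∙xz to *-swapˡ)
open import Data.Nat.Tactic.RingSolver using (solve-∀)
open import Data.Product using (_,_; proj₁; proj₂; ∃-syntax)
open import Data.Sum using (inj₁; inj₂)
open import Data.Unit using (⊤; tt)
open import Data.Vec using (Vec; []; _∷_; lookup; tabulate; zipWith)
import Data.Vec as Vec
import Data.Vec.Properties as Vecₚ
open import Function using (_∘_; id; mk⇔)
open import Relation.Binary.PropositionalEquality
open import Relation.Nullary
open import Relation.Nullary.Decidable using (dec-true; dec-false; does-⇔; decidable-stable; _×-dec_; ¬?)

-- The two rounds resolve a conflict of sizes. The kept set must be independent at the end. A block
-- of k vertices is independent with probability 2^(-k(k-1)/2), so fewer than n disjoint blocks are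
-- sure enough to contain an independent one only for k of order √(log n). Wearing down a clique of
-- up to n vertices by constant factors, however, takes about log n kept vertices. The reservoir
-- bridges this gap: it need not be independent, because its vertices are released afterwards and
-- add only O(log n) to the clique, against which √(log n) kept vertices suffice. The second round
-- is what limits the bound to exp(-c√(log n)).
--
-- Probabilities are counts over `tris n`, and edges are resampled by toggles that permute the
-- graphs. A toggle at a kept vertex `q` is compensated at one fixed kept vertex `z`, so all earlier
-- deletions stay legal while the adjacency of `q` to the clique becomes uniform. The toggles of
-- both rounds change no edge inside a block, hence they respect the event that a given block is the
-- first independent one.

private variable
  A B : Set
  m n : ℕ

-- Finite sums and the space of graphs

∑ : List A → (A → ℕ) → ℕ
∑ []       f = 0
∑ (x ∷ xs) f = f x + ∑ xs f

∑-cong : ∀ (xs : List A) {f g : A → ℕ} → (∀ x → f x ≡ g x) → ∑ xs f ≡ ∑ xs g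
∑-cong []       e = refl
∑-cong (x ∷ xs) e = cong₂ _+_ (e x) (∑-cong xs e)

∑-mono : ∀ (xs : List A) {f g : A → ℕ} → (∀ x → f x ≤ g x) → ∑ xs f ≤ ∑ xs g
∑-mono []       e = z≤n
∑-mono (x ∷ xs) e = +-mono-≤ (e x) (∑-mono xs e)

∑-distrib-+ : ∀ (xs : List A) (f g : A → ℕ) → ∑ xs (λ x → f x + g x) ≡ ∑ xs f + ∑ xs g
∑-distrib-+ []       f g = refl
∑-distrib-+ (x ∷ xs) f g rewrite ∑-distrib-+ xs f g =
  +-interchange (f x) (g x) (∑ xs f) (∑ xs g)

*-distribˡ-∑ : ∀ c (xs : List A) (f : A → ℕ) → c * ∑ xs f ≡ ∑ xs (λ x → c * f x)
*-distribˡ-∑ c []       f = *-zeroʳ c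
*-distribˡ-∑ c (x ∷ xs) f = trans (*-distribˡ-+ c (f x) _) (cong (c * f x +_) (*-distribˡ-∑ c xs f))

∑-const : ∀ (xs : List A) c → ∑ xs (λ _ → c) ≡ length xs * c
∑-const []       c = refl
∑-const (x ∷ xs) c = cong (c +_) (∑-const xs c)

∑-zero : ∀ (xs : List A) → ∑ xs (λ _ → 0) ≡ 0
∑-zero xs = trans (∑-const xs 0) (*-zeroʳ (length xs))

∑-++ : ∀ (xs ys : List A) (f : A → ℕ) → ∑ (xs ++ ys) f ≡ ∑ xs f + ∑ ys f
∑-++ []       ys f = refl
∑-++ (x ∷ xs) ys f = trans (cong (f x +_) (∑-++ xs ys f)) (sym (+-assoc (f x) _ _))

∑-map : ∀ (g : A → B) xs (f : B → ℕ) → ∑ (map g xs) f ≡ ∑ xs (f ∘ g)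
∑-map g []       f = refl
∑-map g (x ∷ xs) f = cong (f (g x) +_) (∑-map g xs f)

∑-comm : ∀ (xs : List A) (ys : List B) (f : A → B → ℕ) →
         ∑ xs (λ x → ∑ ys (f x)) ≡ ∑ ys (λ y → ∑ xs (λ x → f x y))
∑-comm []       ys f = sym (∑-zero ys)
∑-comm (x ∷ xs) ys f =
  trans (cong (∑ ys (f x) +_) (∑-comm xs ys f)) (sym (∑-distrib-+ ys (f x) _))

∑-cartesianProduct : ∀ (xs : List A) (ys : List B) (f : A × B → ℕ) →
                     ∑ (cartesianProduct xs ys) f ≡ ∑ xs (λ x → ∑ ys (λ y → f (x , y)))
∑-cartesianProduct []       ys f = refl
∑-cartesianProduct (x ∷ xs) ys f =
  trans (∑-++ (map (x ,_) ys) _ f)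
        (cong₂ _+_ (∑-map (x ,_) ys f) (∑-cartesianProduct xs ys f))

length-cartesianProduct : ∀ (xs : List A) (ys : List B) →
                          length (cartesianProduct xs ys) ≡ length xs * length ys
length-cartesianProduct []       ys = refl
length-cartesianProduct (x ∷ xs) ys = trans (length-++ (map (x ,_) ys))
  (cong₂ _+_ (length-map (x ,_) ys) (length-cartesianProduct xs ys))

∈⇒≤∑ : ∀ {xs : List A} {x} (f : A → ℕ) → x ∈ xs → f x ≤ ∑ xs f
∈⇒≤∑ f (here refl) = m≤m+n _ _
∈⇒≤∑ f (there x∈)  = ≤-trans (∈⇒≤∑ f x∈) (m≤n+m _ _)

bit : Bool → ℕ
bit b = if b then 1 else 0

bit≤1 : ∀ b → bit b ≤ 1
bit≤1 true  = ≤-refl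
bit≤1 false = z≤n

bit-∧ : ∀ b c → bit (b ∧ c) ≡ bit b * bit c
bit-∧ true  c = sym (+-identityʳ (bit c))
bit-∧ false c = refl

bit-split : ∀ b c → bit b ≡ bit (b ∧ c) + bit (b ∧ not c)
bit-split true  true  = refl
bit-split true  false = refl
bit-split false c     = refl

∑-bit≤length : ∀ (xs : List A) (p : A → Bool) → ∑ xs (bit ∘ p) ≤ length xs
∑-bit≤length xs p = ≤-trans (∑-mono xs (λ x → bit≤1 (p x))) (≤-reflexive (trans (∑-const xs 1) (*-identityʳ _)))

∑-bit<length : ∀ {xs : List A} {x} (p : A → Bool) → x ∈ xs → p x ≡ false → ∑ xs (bit ∘ p) < length xs
∑-bit<length {xs = x ∷ xs} p (here refl) e rewrite e = s≤s (∑-bit≤length xs p)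
∑-bit<length {xs = x ∷ xs} p (there x∈)  e = +-mono-≤-< (bit≤1 (p x)) (∑-bit<length p x∈ e)

vecs : ∀ n → List (Vec Bool n)
vecs zero    = [] ∷ []
vecs (suc n) = map (true ∷_) (vecs n) ++ map (false ∷_) (vecs n)

∑-vecs-suc : ∀ (f : Vec Bool (suc n) → ℕ) →
             ∑ (vecs (suc n)) f ≡ ∑ (vecs n) (f ∘ (true ∷_)) + ∑ (vecs n) (f ∘ (false ∷_))
∑-vecs-suc {n} f = trans (∑-++ (map (true ∷_) (vecs n)) _ f)
  (cong₂ _+_ (∑-map (true ∷_) (vecs n) f) (∑-map (false ∷_) (vecs n) f))

length-vecs : ∀ n → length (vecs n) ≡ 2 ^ n
length-vecs zero    = refl
length-vecs (suc n) = begin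
  length (vecs (suc n))                                  ≡⟨ length-++ (map (true ∷_) (vecs n)) ⟩
  length (map (true ∷_) (vecs n)) + length (map (false ∷_) (vecs n))
    ≡⟨ cong₂ _+_ (trans (length-map _ (vecs n)) (length-vecs n)) (trans (length-map _ (vecs n)) (length-vecs n)) ⟩
  2 ^ n + 2 ^ n                                          ≡⟨ cong (2 ^ n +_) (sym (+-identityʳ _)) ⟩
  2 ^ suc n                                              ∎
  where open ≡-Reasoning

∈-vecs : ∀ (v : Vec Bool n) → v ∈ vecs n
∈-vecs []          = here refl
∈-vecs (true ∷ v)  = ∈-++⁺ˡ (∈-map⁺ _ (∈-vecs v))
∈-vecs (false ∷ v) = ∈-++⁺ʳ _ (∈-map⁺ _ (∈-vecs v))

∑-vecs-xor : ∀ (u : Vec Bool n) (f : Vec Bool n → ℕ) →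
             ∑ (vecs n) (λ v → f (zipWith _xor_ v u)) ≡ ∑ (vecs n) f
∑-vecs-xor [] f = refl
∑-vecs-xor {suc n} (b ∷ u) f = begin
  ∑ (vecs (suc n)) (λ v → f (zipWith _xor_ v (b ∷ u)))
    ≡⟨ ∑-vecs-suc {n} (λ v → f (zipWith _xor_ v (b ∷ u))) ⟩
  ∑ (vecs n) (λ v → f (not b ∷ zipWith _xor_ v u)) + ∑ (vecs n) (λ v → f (b ∷ zipWith _xor_ v u))
    ≡⟨ cong₂ _+_ (∑-vecs-xor u (λ v → f (not b ∷ v))) (∑-vecs-xor u (λ v → f (b ∷ v))) ⟩
  ∑ (vecs n) (λ v → f (not b ∷ v)) + ∑ (vecs n) (λ v → f (b ∷ v))
    ≡⟨ swap-heads b ⟩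
  ∑ (vecs n) (λ v → f (true ∷ v)) + ∑ (vecs n) (λ v → f (false ∷ v))
    ≡⟨ sym (∑-vecs-suc f) ⟩
  ∑ (vecs (suc n)) f ∎
  where
  open ≡-Reasoning
  swap-heads : ∀ b → ∑ (vecs n) (λ v → f (not b ∷ v)) + ∑ (vecs n) (λ v → f (b ∷ v))
                   ≡ ∑ (vecs n) (λ v → f (true ∷ v)) + ∑ (vecs n) (λ v → f (false ∷ v))
  swap-heads true  = +-comm (∑ (vecs n) (λ v → f (false ∷ v))) _
  swap-heads false = refl

-- A simple graph, stored as the rows of its strict upper triangle.
Tri : ℕ → Set
Tri zero    = ⊤
Tri (suc n) = Vec Bool n × Tri n

tris : ∀ n → List (Tri n)
tris zero    = tt ∷ []
tris (suc n) = cartesianProduct (vecs n) (tris n)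

length-tris : ∀ n → length (tris n) ≡ 2 ^ (n C 2)
length-tris zero    = refl
length-tris (suc n) = begin
  length (tris (suc n))             ≡⟨ length-cartesianProduct (vecs n) (tris n) ⟩
  length (vecs n) * length (tris n) ≡⟨ cong₂ _*_ (length-vecs n) (length-tris n) ⟩
  2 ^ n * 2 ^ (n C 2)               ≡⟨ sym (^-distribˡ-+-* 2 n (n C 2)) ⟩
  2 ^ (n + n C 2)                   ≡⟨ cong (λ m → 2 ^ (m + n C 2)) (sym (nC1≡n n)) ⟩
  2 ^ (n C 1 + n C 2)               ≡⟨ cong (2 ^_) (nCk+nC[k+1]≡[n+1]C[k+1] n 1) ⟩
  2 ^ (suc n C 2)                   ∎
  where open ≡-Reasoning

length-tris≤ : ∀ n → length (tris n) ≤ 2 ^ (n * n)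
length-tris≤ zero    = ≤-refl
length-tris≤ (suc n) = begin
  length (tris (suc n))             ≡⟨ length-cartesianProduct (vecs n) (tris n) ⟩
  length (vecs n) * length (tris n) ≤⟨ *-mono-≤ (≤-reflexive (length-vecs n)) (length-tris≤ n) ⟩
  2 ^ n * 2 ^ (n * n)               ≡⟨ sym (^-distribˡ-+-* 2 n (n * n)) ⟩
  2 ^ (n + n * n)                   ≤⟨ ^-monoʳ-≤ 2 (m≤n+m (n + n * n) (suc n)) ⟩
  2 ^ (suc n + (n + n * n))         ≡⟨ cong (2 ^_) (square n) ⟩
  2 ^ (suc n * suc n)               ∎
  where
  open ≤-Reasoning
  square : ∀ n → suc n + (n + n * n) ≡ suc n * suc n
  square = solve-∀

∈-tris : ∀ (t : Tri n) → t ∈ tris n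
∈-tris {zero}  tt      = here refl
∈-tris {suc n} (r , t) = ∈-cartesianProduct⁺ (∈-vecs r) (∈-tris t)

_⊕_ : Tri n → Tri n → Tri n
_⊕_ {zero}  _       _       = tt
_⊕_ {suc n} (r , t) (s , u) = zipWith _xor_ r s , t ⊕ u

-- Toggling a fixed set of edges permutes the graphs. Every probability estimate below averages over
-- such toggles.
∑-tris-⊕ : ∀ (u : Tri n) (f : Tri n → ℕ) → ∑ (tris n) (λ t → f (t ⊕ u)) ≡ ∑ (tris n) f
∑-tris-⊕ {zero}  u       f = refl
∑-tris-⊕ {suc n} (s , u) f = begin
  ∑ (tris (suc n)) (λ t → f (t ⊕ (s , u)))
    ≡⟨ ∑-cartesianProduct (vecs n) (tris n) _ ⟩
  ∑ (vecs n) (λ r → ∑ (tris n) (λ t → f (zipWith _xor_ r s , t ⊕ u)))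
    ≡⟨ ∑-cong (vecs n) (λ r → ∑-tris-⊕ u (λ t → f (zipWith _xor_ r s , t))) ⟩
  ∑ (vecs n) (λ r → ∑ (tris n) (λ t → f (zipWith _xor_ r s , t)))
    ≡⟨ ∑-vecs-xor s (λ r → ∑ (tris n) (λ t → f (r , t))) ⟩
  ∑ (vecs n) (λ r → ∑ (tris n) (λ t → f (r , t)))
    ≡⟨ sym (∑-cartesianProduct (vecs n) (tris n) f) ⟩
  ∑ (tris (suc n)) f ∎
  where open ≡-Reasoning

-- The existence of a deletion path of a given kind comes with no decision procedure. Finitely many
-- instances of excluded middle hold under a double negation, which is enough because the inequality
-- between numbers to be proved is decidable.
¬¬-decidable : ∀ (xs : List A) (P : A → Set) → ¬ ¬ (∀ {x} → x ∈ xs → Dec (P x))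
¬¬-decidable []       P k = k λ ()
¬¬-decidable (x ∷ xs) P k = ¬¬-excluded-middle λ d → ¬¬-decidable xs P λ ds →
  k λ { (here refl) → d ; (there x∈) → ds x∈ }

adj : Tri n → Fin n → Fin n → Bool
adj (r , t) zero    zero    = false
adj (r , t) zero    (suc j) = lookup r j
adj (r , t) (suc i) zero    = lookup r i
adj (r , t) (suc i) (suc j) = adj t i j

adj-sym : ∀ (t : Tri n) i j → adj t i j ≡ adj t j i
adj-sym (r , t) zero    zero    = refl
adj-sym (r , t) zero    (suc j) = refl
adj-sym (r , t) (suc i) zero    = refl
adj-sym (r , t) (suc i) (suc j) = adj-sym t i j

adj-irrefl : ∀ (t : Tri n) i → adj t i i ≡ false
adj-irrefl (r , t) zero    = refl
adj-irrefl (r , t) (suc i) = adj-irrefl t i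

adj-⊕ : ∀ (t u : Tri n) i j → adj (t ⊕ u) i j ≡ adj t i j xor adj u i j
adj-⊕ (r , t) (s , u) zero    zero    = refl
adj-⊕ (r , t) (s , u) zero    (suc j) = Vecₚ.lookup-zipWith _xor_ j r s
adj-⊕ (r , t) (s , u) (suc i) zero    = Vecₚ.lookup-zipWith _xor_ i r s
adj-⊕ (r , t) (s , u) (suc i) (suc j) = adj-⊕ t u i j

triangle : (Fin n → Fin n → Bool) → Tri n
triangle {zero}  f = tt
triangle {suc n} f = tabulate (λ j → f zero (suc j)) , triangle (λ i j → f (suc i) (suc j))

adj-triangle : ∀ (f : Fin n → Fin n → Bool) → (∀ i j → f i j ≡ f j i) → (∀ i → f i i ≡ false) →
               ∀ i j → adj (triangle f) i j ≡ f i j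
adj-triangle f sy ir zero    zero    = sym (ir zero)
adj-triangle f sy ir zero    (suc j) = Vecₚ.lookup∘tabulate _ j
adj-triangle f sy ir (suc i) zero    = trans (Vecₚ.lookup∘tabulate _ i) (sy zero (suc i))
adj-triangle f sy ir (suc i) (suc j) = adj-triangle _ (λ i j → sy (suc i) (suc j)) (λ i → ir (suc i)) i j

-- Sums modulo 2 and vertex sets

VSet : ℕ → Set
VSet n = Fin n → Bool

⨁ : VSet n → Bool
⨁ {zero}  f = false
⨁ {suc n} f = f zero xor ⨁ (f ∘ suc)

⨁-cong : {f g : VSet n} → (∀ x → f x ≡ g x) → ⨁ f ≡ ⨁ g
⨁-cong {zero}  e = refl
⨁-cong {suc n} e = cong₂ _xor_ (e zero) (⨁-cong (e ∘ suc))

xor-interchange : ∀ a b c d → (a xor b) xor (c xor d) ≡ (a xor c) xor (b xor d)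
xor-interchange = solve 4 (λ a b c d → (a :+ b) :+ (c :+ d) := (a :+ c) :+ (b :+ d)) refl
  where open xor-∧-Solver

⨁-xor : ∀ (f g : VSet n) → ⨁ (λ x → f x xor g x) ≡ ⨁ f xor ⨁ g
⨁-xor {zero}  f g = refl
⨁-xor {suc n} f g = trans (cong ((f zero xor g zero) xor_) (⨁-xor (f ∘ suc) (g ∘ suc)))
                          (xor-interchange (f zero) (g zero) _ _)

⨁-false : ⨁ {n} (λ _ → false) ≡ false
⨁-false {zero}  = refl
⨁-false {suc n} = ⨁-false {n}

⨁-≡false : {f : VSet n} → (∀ x → f x ≡ false) → ⨁ f ≡ false
⨁-≡false {n} e = trans (⨁-cong e) (⨁-false {n})

⨁-∧ : ∀ b (f : VSet n) → ⨁ (λ x → b ∧ f x) ≡ b ∧ ⨁ f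
⨁-∧     true  f = refl
⨁-∧ {n} false f = ⨁-false {n}

δ : Fin n → VSet n
δ c x = does (c Finₚ.≟ x)

δ-refl : ∀ (c : Fin n) → δ c c ≡ true
δ-refl c = dec-true (c Finₚ.≟ c) refl

δ-≢ : ∀ {c x : Fin n} → c ≢ x → δ c x ≡ false
δ-≢ {c = c} {x} c≢x = dec-false (c Finₚ.≟ x) c≢x

δ-true : ∀ {c x : Fin n} → δ c x ≡ true → c ≡ x
δ-true {c = c} {x} e with c Finₚ.≟ x
... | yes p = p
... | no  _ with () ← e

⨁-δ : ∀ (c : Fin n) (f : VSet n) → ⨁ (λ x → δ c x ∧ f x) ≡ f c
⨁-δ {suc n} zero    f = trans (cong (f zero xor_) (⨁-false {n})) (Boolₚ.xor-identityʳ (f zero))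
⨁-δ {suc n} (suc c) f = ⨁-δ c (f ∘ suc)

_⊻_ : VSet n → VSet n → VSet n
(f ⊻ g) x = f x xor g x

# : VSet n → ℕ
# {zero}  f = 0
# {suc n} f = bit (f zero) + # (f ∘ suc)

#-cong : {f g : VSet n} → (∀ x → f x ≡ g x) → # f ≡ # g
#-cong {zero}  e = refl
#-cong {suc n} e = cong₂ _+_ (cong bit (e zero)) (#-cong (e ∘ suc))

_⊑_ : VSet n → VSet n → Set
f ⊑ g = ∀ x → f x ≡ true → g x ≡ true

bit-mono : ∀ {b c} → (b ≡ true → c ≡ true) → bit b ≤ bit c
bit-mono {false} e = z≤n
bit-mono {true}  e rewrite e refl = ≤-refl

#-mono : {f g : VSet n} → f ⊑ g → # f ≤ # g
#-mono {zero}  e = z≤n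
#-mono {suc n} e = +-mono-≤ (bit-mono (e zero)) (#-mono (e ∘ suc))

#≤n : ∀ (f : VSet n) → # f ≤ n
#≤n {zero}  f = z≤n
#≤n {suc n} f = +-mono-≤ (bit≤1 (f zero)) (#≤n (f ∘ suc))

#-remove : ∀ {f g : VSet n} c → f c ≡ true → g c ≡ false → (∀ x → c ≢ x → f x ≡ g x) → # f ≡ suc (# g)
#-remove {suc n} zero fc gc e rewrite fc | gc = cong suc (#-cong (λ x → e (suc x) λ ()))
#-remove {suc n} {f} {g} (suc c) fc gc e = begin
  bit (f zero) + # (f ∘ suc)       ≡⟨ cong₂ _+_ (cong bit (e zero λ ())) (#-remove c fc gc (λ x c≢x → e (suc x) (c≢x ∘ Finₚ.suc-injective))) ⟩
  bit (g zero) + suc (# (g ∘ suc)) ≡⟨ +-suc _ _ ⟩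
  suc (# g)                        ∎
  where open ≡-Reasoning

#-strict : ∀ {f g : VSet n} c → f ⊑ g → f c ≡ false → g c ≡ true → # f < # g
#-strict {suc n} {f} {g} zero e fc gc rewrite fc | gc = s≤s (#-mono (e ∘ suc))
#-strict {suc n} {f} {g} (suc c) e fc gc = +-mono-≤-< (bit-mono (e zero)) (#-strict c (e ∘ suc) fc gc)

#-∧-not : ∀ (f g : VSet n) → # (λ x → f x ∧ g x) + # (λ x → f x ∧ not (g x)) ≡ # f
#-∧-not {zero}  f g = refl
#-∧-not {suc n} f g = trans (+-interchange (bit (f zero ∧ g zero)) _ (bit (f zero ∧ not (g zero))) _)
  (cong₂ _+_ (sym (bit-split (f zero) (g zero))) (#-∧-not (f ∘ suc) (g ∘ suc)))

#≡0⇒false : ∀ (f : VSet n) → # f ≡ 0 → ∀ x → f x ≡ false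
#≡0⇒false f e x with f x in fx
... | false = refl
... | true  with () ← subst (0 <_) e (≤-trans (s≤s z≤n) (#-strict {f = λ _ → false} x (λ _ ()) refl fx))

#>0⇒∃ : ∀ (f : VSet n) → 0 < # f → ∃[ x ] f x ≡ true
#>0⇒∃ {suc n} f p with f zero in e
... | true  = zero , e
... | false with #>0⇒∃ (f ∘ suc) p
...   | x , fx = suc x , fx

#-∪ : ∀ {f g h : VSet n} → (∀ x → f x ≡ true → g x ≡ false → h x ≡ true) → # f ≤ # g + # h
#-∪ {zero}  e = z≤n
#-∪ {suc n} {f} {g} {h} e = begin
  bit (f zero) + # (f ∘ suc) ≤⟨ +-mono-≤ (head (f zero) (g zero) (e zero)) (#-∪ (e ∘ suc)) ⟩
  (bit (g zero) + bit (h zero)) + (# (g ∘ suc) + # (h ∘ suc)) ≡⟨ +-interchange (bit (g zero)) _ _ _ ⟩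
  # g + # h ∎
  where
  open ≤-Reasoning
  head : ∀ b c {d} → (b ≡ true → c ≡ false → d ≡ true) → bit b ≤ bit c + bit d
  head false c     e = z≤n
  head true  true  e = s≤s z≤n
  head true  false e rewrite e refl refl = ≤-refl

odd : ℕ → Bool
odd zero    = false
odd (suc n) = not (odd n)

⨁-odd : ∀ (f : VSet n) → ⨁ f ≡ odd (# f)
⨁-odd {zero}  f = refl
⨁-odd {suc n} f with f zero
... | true  = cong not (⨁-odd (f ∘ suc))
... | false = ⨁-odd (f ∘ suc)

Adj : ℕ → Set
Adj n = Fin n → Fin n → Bool

deg : Adj n → VSet n → VSet n
deg a V x = ⨁ (λ y → V y ∧ a x y)

deg-cong : ∀ (a : Adj n) {V W : VSet n} → (∀ x → V x ≡ W x) → ∀ x → deg a V x ≡ deg a W x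
deg-cong a e x = ⨁-cong (λ y → cong (_∧ a x y) (e y))

deg-⊻ : ∀ (a : Adj n) V W x → deg a (V ⊻ W) x ≡ deg a V x xor deg a W x
deg-⊻ a V W x = trans (⨁-cong (λ y → Boolₚ.∧-distribʳ-xor (a x y) (V y) (W y)))
                      (⨁-xor (λ y → V y ∧ a x y) (λ y → W y ∧ a x y))

deg-δ : ∀ (a : Adj n) c x → deg a (δ c) x ≡ a x c
deg-δ a c x = ⨁-δ c (a x)

edgeParity : Tri n → VSet n → Bool
edgeParity {zero}  t       V = false
edgeParity {suc n} (r , t) V = (V zero ∧ ⨁ (λ j → V (suc j) ∧ lookup r j)) xor edgeParity t (V ∘ suc)

-- Over the field with two elements the edge parity is a quadratic form in the vertex set, and the
-- last sum is its polar form. For `T ⊑ V` the set `V ⊻ T` is what remains after deleting `T`.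
edgeParity-⊻ : ∀ (t : Tri n) V T →
          edgeParity t (V ⊻ T) ≡ (edgeParity t V xor edgeParity t T) xor ⨁ (λ x → T x ∧ deg (adj t) V x)
edgeParity-⊻ {zero}  t       V T = refl
edgeParity-⊻ {suc n} (r , t) V T = begin
  ((v xor w) ∧ ⨁ (λ j → (V (suc j) xor T (suc j)) ∧ lookup r j)) xor edgeParity t ((V ⊻ T) ∘ suc)
    ≡⟨ cong₂ (λ a b → ((v xor w) ∧ a) xor b)
         (trans (⨁-cong (λ j → Boolₚ.∧-distribʳ-xor (lookup r j) (V (suc j)) (T (suc j)))) (⨁-xor (λ j → V (suc j) ∧ lookup r j) _))
         (edgeParity-⊻ t (V ∘ suc) (T ∘ suc)) ⟩
  ((v xor w) ∧ (p xor q)) xor ((e xor e′) xor c)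
    ≡⟨ rearrange v w p q e e′ c ⟩
  (((v ∧ p) xor e) xor ((w ∧ q) xor e′)) xor ((w ∧ p) xor ((v ∧ q) xor c))
    ≡⟨ cong (λ z → (((v ∧ p) xor e) xor ((w ∧ q) xor e′)) xor z) (sym cross) ⟩
  (((v ∧ p) xor e) xor ((w ∧ q) xor e′)) xor ⨁ (λ x → T x ∧ deg (adj (r , t)) V x) ∎
  where
  open ≡-Reasoning
  v = V zero
  w = T zero
  p = ⨁ (λ j → V (suc j) ∧ lookup r j)
  q = ⨁ (λ j → T (suc j) ∧ lookup r j)
  e = edgeParity t (V ∘ suc)
  e′ = edgeParity t (T ∘ suc)
  c = ⨁ (λ x → T (suc x) ∧ deg (adj t) (V ∘ suc) x)
  swap : ∀ a b c → a ∧ (b ∧ c) ≡ b ∧ (a ∧ c)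
  swap true  true  c = refl
  swap true  false c = refl
  swap false true  c = refl
  swap false false c = refl
  cross : ⨁ (λ x → T x ∧ deg (adj (r , t)) V x) ≡ (w ∧ p) xor ((v ∧ q) xor c)
  cross = cong₂ _xor_ (cong (λ b → w ∧ (b xor p)) (Boolₚ.∧-zeroʳ v))
    (begin
      ⨁ (λ x → T (suc x) ∧ ((v ∧ lookup r x) xor deg (adj t) (V ∘ suc) x))
        ≡⟨ ⨁-cong (λ x → trans (Boolₚ.∧-distribˡ-xor (T (suc x)) _ _) (cong (_xor (T (suc x) ∧ deg (adj t) (V ∘ suc) x)) (swap (T (suc x)) v (lookup r x)))) ⟩
      ⨁ (λ x → (v ∧ (T (suc x) ∧ lookup r x)) xor (T (suc x) ∧ deg (adj t) (V ∘ suc) x))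
        ≡⟨ ⨁-xor (λ x → v ∧ (T (suc x) ∧ lookup r x)) _ ⟩
      ⨁ (λ x → v ∧ (T (suc x) ∧ lookup r x)) xor c
        ≡⟨ cong (_xor c) (⨁-∧ v (λ x → T (suc x) ∧ lookup r x)) ⟩
      (v ∧ q) xor c ∎)
  rearrange : ∀ v w p q e e′ c → ((v xor w) ∧ (p xor q)) xor ((e xor e′) xor c)
            ≡ (((v ∧ p) xor e) xor ((w ∧ q) xor e′)) xor ((w ∧ p) xor ((v ∧ q) xor c))
  rearrange = solve 7 (λ v w p q e e′ c → ((v :+ w) :* (p :+ q)) :+ ((e :+ e′) :+ c)
    := (((v :* p) :+ e) :+ ((w :* q) :+ e′)) :+ ((w :* p) :+ ((v :* q) :+ c))) refl
    where open xor-∧-Solver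

edgeParity-independent : ∀ (t : Tri n) V → (∀ x y → V x ≡ true → V y ≡ true → adj t x y ≡ false) → edgeParity t V ≡ false
edgeParity-independent {zero}  t       V ind = refl
edgeParity-independent {suc n} (r , t) V ind =
  cong₂ _xor_ top (edgeParity-independent t (V ∘ suc) (λ x y → ind (suc x) (suc y)))
  where
  top : V zero ∧ ⨁ (λ j → V (suc j) ∧ lookup r j) ≡ false
  top with V zero in v₀
  ... | false = refl
  ... | true  = ⨁-≡false λ j → cell j (V (suc j)) refl
    where
    cell : ∀ j b → V (suc j) ≡ b → V (suc j) ∧ lookup r j ≡ false
    cell j false e rewrite e = refl
    cell j true  e rewrite e = ind zero (suc j) v₀ e

edgeParity-cong : ∀ (t : Tri n) {V W : VSet n} → (∀ x → V x ≡ W x) → edgeParity t V ≡ edgeParity t W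
edgeParity-cong {zero}  t       e = refl
edgeParity-cong {suc n} (r , t) e = cong₂ _xor_
  (cong₂ _∧_ (e zero) (⨁-cong (λ j → cong (_∧ lookup r j) (e (suc j))))) (edgeParity-cong t (e ∘ suc))

-- The expected decrease of a random split

-- walk m h is the sum over all A ⊆ [m] of h ∣A∣ (m ∸ ∣A∣).
walk : ℕ → (ℕ → ℕ → ℕ) → ℕ
walk zero    h = h 0 0
walk (suc m) h = walk m (λ a b → h (suc a) b) + walk m (λ a b → h a (suc b))

walk-mono : ∀ m {h k} → (∀ a b → a + b ≡ m → h a b ≤ k a b) → walk m h ≤ walk m k
walk-mono zero    e = e 0 0 refl
walk-mono (suc m) e = +-mono-≤ (walk-mono m (λ a b p → e (suc a) b (cong suc p)))
                               (walk-mono m (λ a b p → e a (suc b) (trans (+-suc a b) (cong suc p))))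

walk-cong : ∀ m {h k} → (∀ a b → h a b ≡ k a b) → walk m h ≡ walk m k
walk-cong zero    e = e 0 0
walk-cong (suc m) e = cong₂ _+_ (walk-cong m (λ a b → e (suc a) b)) (walk-cong m (λ a b → e a (suc b)))

walk-+ : ∀ m h k → walk m (λ a b → h a b + k a b) ≡ walk m h + walk m k
walk-+ zero    h k = refl
walk-+ (suc m) h k = trans
  (cong₂ _+_ (walk-+ m (λ a b → h (suc a) b) (λ a b → k (suc a) b))
             (walk-+ m (λ a b → h a (suc b)) (λ a b → k a (suc b))))
  (+-interchange (walk m (λ a b → h (suc a) b)) _ (walk m (λ a b → h a (suc b))) _)

walk-* : ∀ c m h → walk m (λ a b → c * h a b) ≡ c * walk m h
walk-* c zero    h = refl
walk-* c (suc m) h = trans (cong₂ _+_ (walk-* c m _) (walk-* c m _)) (sym (*-distribˡ-+ c _ _))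

walk-const : ∀ m c → walk m (λ _ _ → c) ≡ 2 ^ m * c
walk-const zero    c = sym (+-identityʳ c)
walk-const (suc m) c = trans (cong (λ z → z + z) (walk-const m c)) (double (2 ^ m) c)
  where
  double : ∀ x c → x * c + x * c ≡ 2 * x * c
  double = solve-∀

-- The shift by `N` only relabels the choice made at each vertex of `M`, so the two counts are those
-- of a uniform split of `M`. The coordinates of `y` outside `M` are free and contribute the power
-- of two.
∑-vecs-walk : ∀ (M N : VSet n) (h : ℕ → ℕ → ℕ) →
  ∑ (vecs n) (λ y → h (# (λ x → M x ∧ (N x xor lookup y x))) (# (λ x → M x ∧ not (N x xor lookup y x))))
  ≡ 2 ^ # (not ∘ M) * walk (# M) h
∑-vecs-walk {zero}  M N h = refl
∑-vecs-walk {suc n} M N h = trans (∑-vecs-suc {n} _) (split (M zero) (N zero))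
  where
  open ≡-Reasoning
  M′ = M ∘ suc
  N′ = N ∘ suc
  k = 2 ^ # (not ∘ M′)
  in# out# : Vec Bool n → ℕ
  in#  y = # (λ x → M′ x ∧ (N′ x xor lookup y x))
  out# y = # (λ x → M′ x ∧ not (N′ x xor lookup y x))
  split : ∀ m₀ n₀ →
    ∑ (vecs n) (λ y → h (bit (m₀ ∧ (n₀ xor true)) + in# y) (bit (m₀ ∧ not (n₀ xor true)) + out# y))
    + ∑ (vecs n) (λ y → h (bit (m₀ ∧ (n₀ xor false)) + in# y) (bit (m₀ ∧ not (n₀ xor false)) + out# y))
    ≡ 2 ^ (bit (not m₀) + # (not ∘ M′)) * walk (bit m₀ + # M′) h
  split false n₀ = begin
    _ ≡⟨ cong₂ _+_ (∑-vecs-walk M′ N′ h) (∑-vecs-walk M′ N′ h) ⟩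
    k * walk (# M′) h + k * walk (# M′) h ≡⟨ double k _ ⟩
    2 * k * walk (# M′) h ∎
    where
    double : ∀ x c → x * c + x * c ≡ 2 * x * c
    double = solve-∀
  split true true = begin
    _ ≡⟨ cong₂ _+_ (∑-vecs-walk M′ N′ (λ a b → h a (suc b))) (∑-vecs-walk M′ N′ (λ a b → h (suc a) b)) ⟩
    _ ≡⟨ +-comm (k * walk (# M′) (λ a b → h a (suc b))) _ ⟩
    _ ≡⟨ sym (*-distribˡ-+ k _ _) ⟩
    k * walk (suc (# M′)) h ∎
  split true false = begin
    _ ≡⟨ cong₂ _+_ (∑-vecs-walk M′ N′ (λ a b → h (suc a) b)) (∑-vecs-walk M′ N′ (λ a b → h a (suc b))) ⟩
    _ ≡⟨ sym (*-distribˡ-+ k _ _) ⟩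
    k * walk (suc (# M′)) h ∎

#-not : ∀ (f : VSet n) → # (not ∘ f) + # f ≡ n
#-not {zero}  f = refl
#-not {suc n} f with f zero
... | true  = trans (+-suc _ _) (cong suc (#-not (f ∘ suc)))
... | false = cong suc (#-not (f ∘ suc))

-- Indicator of `odd a ≡ t`. If a vertex has `a` neighbours in the clique and `t` is the parity of
-- its other edges, this is the event that its degree is even, so that it may be deleted.
par : Bool → ℕ → ℕ
par t a = bit (not (odd a xor t))

par-suc : ∀ t a → par t (suc a) ≡ par (not t) a
par-suc true  a = cong (bit ∘ not) (trans (Boolₚ.xor-annihilates-not (odd a) false) refl)
par-suc false a = cong (bit ∘ not) (sym (xor-not (odd a)))
  where
  xor-not : ∀ b → b xor true ≡ not b xor false
  xor-not true  = refl
  xor-not false = refl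

parity-count : ∀ t m → 2 * walk (suc m) (λ a b → par t a) ≡ 2 ^ suc m
parity-count true  zero    = refl
parity-count false zero    = refl
parity-count t     (suc m) = begin
  2 * (walk (suc m) (λ a b → par t (suc a)) + walk (suc m) (λ a b → par t a))
    ≡⟨ cong (λ z → 2 * (z + walk (suc m) (λ a b → par t a))) (walk-cong (suc m) (λ a b → par-suc t a)) ⟩
  2 * (walk (suc m) (λ a b → par (not t) a) + walk (suc m) (λ a b → par t a))
    ≡⟨ *-distribˡ-+ 2 (walk (suc m) (λ a b → par (not t) a)) _ ⟩
  2 * walk (suc m) (λ a b → par (not t) a) + 2 * walk (suc m) (λ a b → par t a)
    ≡⟨ cong₂ _+_ (parity-count (not t) m) (parity-count t m) ⟩
  2 ^ suc m + 2 ^ suc m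
    ≡⟨ cong (2 ^ suc m +_) (sym (+-identityʳ (2 ^ suc m))) ⟩
  2 ^ suc (suc m) ∎
  where open ≡-Reasoning

parity-firstˡ : ∀ t m → 4 * walk (2 + m) (λ a b → par t a * a) ≡ (2 + m) * 2 ^ (2 + m)
parity-firstˡ true  zero    = refl
parity-firstˡ false zero    = refl
parity-firstˡ t     (suc m) = begin
  4 * (walk m₂ (λ a b → par t (suc a) * suc a) + walk m₂ (λ a b → par t a * a))
    ≡⟨ cong (λ z → 4 * (z + walk m₂ (λ a b → par t a * a)))
         (trans (walk-cong m₂ (λ a b → trans (cong (_* suc a) (par-suc t a)) (*-suc (par (not t) a) a))) (walk-+ m₂ (λ a b → par (not t) a) (λ a b → par (not t) a * a))) ⟩
  4 * ((walk m₂ (λ a b → par (not t) a) + walk m₂ (λ a b → par (not t) a * a)) + walk m₂ (λ a b → par t a * a))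
    ≡⟨ expand (walk m₂ (λ a b → par (not t) a)) _ _ ⟩
  2 * (2 * walk m₂ (λ a b → par (not t) a)) + 4 * walk m₂ (λ a b → par (not t) a * a) + 4 * walk m₂ (λ a b → par t a * a)
    ≡⟨ cong₂ _+_ (cong₂ _+_ (cong (2 *_) (parity-count (not t) (suc m))) (parity-firstˡ (not t) m)) (parity-firstˡ t m) ⟩
  2 * 2 ^ m₂ + m₂ * 2 ^ m₂ + m₂ * 2 ^ m₂
    ≡⟨ collect m (2 ^ m₂) ⟩
  (3 + m) * (2 * 2 ^ m₂) ∎
  where
  open ≡-Reasoning
  m₂ = 2 + m
  expand : ∀ x y z → 4 * ((x + y) + z) ≡ 2 * (2 * x) + 4 * y + 4 * z
  expand = solve-∀
  collect : ∀ m z → 2 * z + (2 + m) * z + (2 + m) * z ≡ (3 + m) * (2 * z)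
  collect = solve-∀

parity-firstʳ : ∀ t m → 4 * walk (2 + m) (λ a b → par t a * b) ≡ (2 + m) * 2 ^ (2 + m)
parity-firstʳ true  zero    = refl
parity-firstʳ false zero    = refl
parity-firstʳ t     (suc m) = begin
  4 * (walk m₂ (λ a b → par t (suc a) * b) + walk m₂ (λ a b → par t a * suc b))
    ≡⟨ cong₂ (λ y z → 4 * (y + z))
         (walk-cong m₂ (λ a b → cong (_* b) (par-suc t a)))
         (trans (walk-cong m₂ (λ a b → *-suc (par t a) b)) (walk-+ m₂ (λ a b → par t a) (λ a b → par t a * b))) ⟩
  4 * (walk m₂ (λ a b → par (not t) a * b) + (walk m₂ (λ a b → par t a) + walk m₂ (λ a b → par t a * b)))
    ≡⟨ expand (walk m₂ (λ a b → par t a)) (walk m₂ (λ a b → par (not t) a * b)) _ ⟩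
  2 * (2 * walk m₂ (λ a b → par t a)) + 4 * walk m₂ (λ a b → par (not t) a * b) + 4 * walk m₂ (λ a b → par t a * b)
    ≡⟨ cong₂ _+_ (cong₂ _+_ (cong (2 *_) (parity-count t (suc m))) (parity-firstʳ (not t) m)) (parity-firstʳ t m) ⟩
  2 * 2 ^ m₂ + m₂ * 2 ^ m₂ + m₂ * 2 ^ m₂
    ≡⟨ collect m (2 ^ m₂) ⟩
  (3 + m) * (2 * 2 ^ m₂) ∎
  where
  open ≡-Reasoning
  m₂ = 2 + m
  expand : ∀ x y z → 4 * (y + (x + z)) ≡ 2 * (2 * x) + 4 * y + 4 * z
  expand = solve-∀
  collect : ∀ m z → 2 * z + (2 + m) * z + (2 + m) * z ≡ (3 + m) * (2 * z)
  collect = solve-∀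

-- Double counting: fix an ordered pair of elements, the first inside and the second outside the
-- subset; half of the splits of the other `1 + m` elements have the required parity. The halving
-- needs a further element, so this moment starts at size three, the first moments at two and the
-- count at one.
parity-mixed : ∀ t m → 8 * walk (3 + m) (λ a b → par t a * (a * b)) ≡ (3 + m) * (2 + m) * 2 ^ (3 + m)
parity-mixed true  zero    = refl
parity-mixed false zero    = refl
parity-mixed t     (suc m) = begin
  8 * (walk m₃ (λ a b → par t (suc a) * (b + a * b)) + walk m₃ (λ a b → par t a * (a * suc b)))
    ≡⟨ cong₂ (λ y z → 8 * (y + z))
         (trans (walk-cong m₃ (λ a b → trans (cong (_* (b + a * b)) (par-suc t a)) (*-distribˡ-+ (par (not t) a) b (a * b)))) (walk-+ m₃ (λ a b → par (not t) a * b) (λ a b → par (not t) a * (a * b))))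
         (trans (walk-cong m₃ (λ a b → trans (cong (par t a *_) (*-suc a b)) (*-distribˡ-+ (par t a) a (a * b)))) (walk-+ m₃ (λ a b → par t a * a) (λ a b → par t a * (a * b)))) ⟩
  8 * ((walk m₃ (λ a b → par (not t) a * b) + walk m₃ (λ a b → par (not t) a * (a * b)))
     + (walk m₃ (λ a b → par t a * a) + walk m₃ (λ a b → par t a * (a * b))))
    ≡⟨ expand (walk m₃ (λ a b → par (not t) a * b)) _ (walk m₃ (λ a b → par t a * a)) _ ⟩
  2 * (4 * walk m₃ (λ a b → par (not t) a * b)) + 2 * (4 * walk m₃ (λ a b → par t a * a))
    + (8 * walk m₃ (λ a b → par (not t) a * (a * b)) + 8 * walk m₃ (λ a b → par t a * (a * b)))
    ≡⟨ cong₂ _+_ (cong₂ (λ y z → 2 * y + 2 * z) (parity-firstʳ (not t) (suc m)) (parity-firstˡ t (suc m)))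
                 (cong₂ _+_ (parity-mixed (not t) m) (parity-mixed t m)) ⟩
  2 * (m₃ * 2 ^ m₃) + 2 * (m₃ * 2 ^ m₃) + (m₃ * (2 + m) * 2 ^ m₃ + m₃ * (2 + m) * 2 ^ m₃)
    ≡⟨ collect m (2 ^ m₃) ⟩
  (4 + m) * (3 + m) * (2 * 2 ^ m₃) ∎
  where
  open ≡-Reasoning
  m₃ = 3 + m
  expand : ∀ x y z w → 8 * ((x + y) + (z + w)) ≡ 2 * (4 * x) + 2 * (4 * z) + (8 * y + 8 * w)
  expand = solve-∀
  collect : ∀ m z → 2 * ((3 + m) * z) + 2 * ((3 + m) * z) + ((3 + m) * (2 + m) * z + (3 + m) * (2 + m) * z)
          ≡ (4 + m) * (3 + m) * (2 * z)
  collect = solve-∀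

-- What remains of a clique with a vertices of even degree and b of odd degree
-- after repeatedly deleting a vertex of even degree: each deletion flips the
-- degree parities of all the others, i.e. (a , b) becomes (b , a ∸ 1).
residue : ℕ → ℕ → ℕ
residue a b = (b ∸ a) + (a ∸ suc b)

residue-swap : ∀ a b → residue (suc a) b ≡ residue b a
residue-swap a b = +-comm (b ∸ suc a) (a ∸ b)

-- Here `a` and `b` count the clique vertices adjacent and non-adjacent to the vertex in use, and
-- `t` is the parity of its remaining degree. If its degree is odd, it stays and so does the clique.
nextSize : Bool → ℕ → ℕ → ℕ
nextSize t a b = if odd a xor t then a + b else residue a b

residue-≤ : ∀ a b → residue a b ≤ a + b
residue-≤ a b with ≤-total a b
... | inj₁ a≤b rewrite m≤n⇒m∸n≡0 (m≤n⇒m≤1+n a≤b) | +-identityʳ (b ∸ a) = ≤-trans (m∸n≤m b a) (m≤n+m b a)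
... | inj₂ b≤a rewrite m≤n⇒m∸n≡0 b≤a = ≤-trans (m∸n≤m a (suc b)) (m≤m+n a b)

nextSize-≤ : ∀ t a b → nextSize t a b ≤ a + b
nextSize-≤ t a b with odd a xor t
... | true  = ≤-refl
... | false = residue-≤ a b

-- `residue a b` is at most |a - b|, and (a + b)|a - b| = |a² - b²| ≤ a² + b². Multiplication by
-- `a + b` turns the bound into a polynomial whose average over all splits is known exactly.
residue-bound : ∀ a b → (a + b) * residue a b + 2 * (a * b) ≤ (a + b) * (a + b)
residue-bound a b with ≤-total a b
... | inj₁ a≤b rewrite m≤n⇒m∸n≡0 (m≤n⇒m≤1+n a≤b) | +-identityʳ (b ∸ a) =
  subst (λ z → (a + z) * (b ∸ a) + 2 * (a * z) ≤ (a + z) * (a + z)) (m+[n∸m]≡n a≤b) (below a (b ∸ a))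
  where
  open ≤-Reasoning
  expand : ∀ a e → (a + (a + e)) * e + 2 * (a * (a + e)) + 2 * (a * a) ≡ (a + (a + e)) * (a + (a + e))
  expand = solve-∀
  below : ∀ a e → (a + (a + e)) * e + 2 * (a * (a + e)) ≤ (a + (a + e)) * (a + (a + e))
  below a e = ≤-trans (m≤m+n _ (2 * (a * a))) (≤-reflexive (expand a e))
... | inj₂ b≤a rewrite m≤n⇒m∸n≡0 b≤a = ≤-trans
  (+-monoˡ-≤ (2 * (a * b)) (*-monoʳ-≤ (a + b) (∸-monoʳ-≤ a (n≤1+n b))))
  (subst (λ z → (z + b) * (a ∸ b) + 2 * (z * b) ≤ (z + b) * (z + b)) (m+[n∸m]≡n b≤a) (above b (a ∸ b)))
  where
  expand : ∀ b e → ((b + e) + b) * e + 2 * ((b + e) * b) + 2 * (b * b) ≡ ((b + e) + b) * ((b + e) + b)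
  expand = solve-∀
  above : ∀ b e → ((b + e) + b) * e + 2 * ((b + e) * b) ≤ ((b + e) + b) * ((b + e) + b)
  above b e = ≤-trans (m≤m+n _ (2 * (b * b))) (≤-reflexive (expand b e))

nextSize-bound : ∀ t a b → (a + b) * nextSize t a b + 2 * (par t a * (a * b)) ≤ (a + b) * (a + b)
nextSize-bound t a b with odd a xor t
... | true  = ≤-reflexive (+-identityʳ _)
... | false rewrite +-identityʳ (a * b) = residue-bound a b

-- Averaging `nextSize-bound` and inserting `parity-mixed` bounds the mean new size by (3s + 1)/4.
-- This is at most 5s/6 precisely for s ≥ 3, with equality at s = 3: here the factor 5/6 arises.
walk-nextSize : ∀ t m → 6 * walk (3 + m) (nextSize t) ≤ 5 * (2 ^ (3 + m) * (3 + m))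
walk-nextSize t m = *-cancelˡ-≤ (4 * s) (+-cancelʳ-≤ (6 * (8 * x)) _ _ (begin
  4 * s * (6 * w) + 6 * (8 * x)                          ≡⟨ factor s w x ⟩
  24 * (s * w + 2 * x)                                   ≤⟨ *-monoʳ-≤ 24 second-moment ⟩
  24 * (p * (s * s))                                     ≤⟨ m≤m+n _ (2 * m * (s * p)) ⟩
  24 * (p * (s * s)) + 2 * m * (s * p)                   ≡⟨ regroup m p ⟩
  4 * s * (5 * (p * s)) + 6 * (s * (2 + m) * p)          ≡⟨ cong (λ z → 4 * s * (5 * (p * s)) + 6 * z) (sym (parity-mixed t m)) ⟩
  4 * s * (5 * (p * s)) + 6 * (8 * x)                    ∎))
  where
  open ≤-Reasoning
  s = 3 + m
  w = walk s (nextSize t)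
  x = walk s (λ a b → par t a * (a * b))
  p = 2 ^ s
  factor : ∀ s w x → 4 * s * (6 * w) + 6 * (8 * x) ≡ 24 * (s * w + 2 * x)
  factor = solve-∀
  regroup : ∀ m p → 24 * (p * ((3 + m) * (3 + m))) + 2 * m * ((3 + m) * p)
          ≡ 4 * (3 + m) * (5 * (p * (3 + m))) + 6 * ((3 + m) * (2 + m) * p)
  regroup = solve-∀
  second-moment : s * w + 2 * x ≤ p * (s * s)
  second-moment = begin
    s * w + 2 * x
      ≡⟨ cong₂ _+_ (sym (walk-* s s (nextSize t))) (sym (walk-* 2 s (λ a b → par t a * (a * b)))) ⟩
    walk s (λ a b → s * nextSize t a b) + walk s (λ a b → 2 * (par t a * (a * b)))
      ≡⟨ sym (walk-+ s (λ a b → s * nextSize t a b) (λ a b → 2 * (par t a * (a * b)))) ⟩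
    walk s (λ a b → s * nextSize t a b + 2 * (par t a * (a * b)))
      ≤⟨ walk-mono s (λ a b e → subst (λ z → z * nextSize t a b + 2 * (par t a * (a * b)) ≤ z * z) e (nextSize-bound t a b)) ⟩
    walk s (λ a b → s * s)
      ≡⟨ walk-const s (s * s) ⟩
    p * (s * s) ∎

-- Sizes up to two count as finished. At size one no contraction can be expected: for `t = false` a
-- single odd vertex survives both outcomes of the split.
potential : ℕ → ℕ
potential 0 = 0
potential 1 = 0
potential 2 = 0
potential (suc (suc (suc m))) = 3 + m

potential-≤ : ∀ m → potential m ≤ m
potential-≤ 0 = z≤n
potential-≤ 1 = z≤n
potential-≤ 2 = z≤n
potential-≤ (suc (suc (suc m))) = ≤-refl

potential-≤2 : ∀ {m} → m ≤ 2 → potential m ≡ 0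
potential-≤2 {0} _ = refl
potential-≤2 {1} _ = refl
potential-≤2 {2} _ = refl
potential-≤2 {suc (suc (suc m))} (s≤s (s≤s ()))

-- One round of the shrinking process: `M` is the surviving clique, `N` the present row of the
-- vertex in use, and `y` the uniform toggle of that row.
potential-drift : ∀ t (M N : VSet n) →
  6 * ∑ (vecs n) (λ y → potential (nextSize t (# (λ x → M x ∧ (N x xor lookup y x)))
                                              (# (λ x → M x ∧ not (N x xor lookup y x)))))
  ≤ 5 * (2 ^ n * potential (# M))
potential-drift {n} t M N = begin
  _ ≡⟨ cong (6 *_) (∑-vecs-walk M N (λ a b → potential (nextSize t a b))) ⟩
  6 * (2 ^ o * walk (# M) (λ a b → potential (nextSize t a b)))
    ≡⟨ *-swapˡ 6 (2 ^ o) _ ⟩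
  2 ^ o * (6 * walk (# M) (λ a b → potential (nextSize t a b)))
    ≤⟨ *-monoʳ-≤ (2 ^ o) (one-step (# M)) ⟩
  2 ^ o * (5 * (2 ^ # M * potential (# M)))
    ≡⟨ assemble (2 ^ o) (2 ^ # M) (potential (# M)) ⟩
  5 * (2 ^ o * 2 ^ # M * potential (# M))
    ≡⟨ cong (λ z → 5 * (z * potential (# M))) (sym (^-distribˡ-+-* 2 o (# M))) ⟩
  5 * (2 ^ (o + # M) * potential (# M))
    ≡⟨ cong (λ z → 5 * (2 ^ z * potential (# M))) (#-not M) ⟩
  5 * (2 ^ n * potential (# M)) ∎
  where
  open ≤-Reasoning
  o = # (not ∘ M)
  assemble : ∀ a b c → a * (5 * (b * c)) ≡ 5 * (a * b * c)
  assemble = solve-∀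
  small : ∀ m → m ≤ 2 → walk m (λ a b → potential (nextSize t a b)) ≤ 0
  small m m≤2 = ≤-trans
    (walk-mono m {k = λ _ _ → 0} (λ a b e → ≤-reflexive (potential-≤2 (≤-trans (nextSize-≤ t a b) (≤-trans (≤-reflexive e) m≤2)))))
    (≤-reflexive (trans (walk-const m 0) (*-zeroʳ (2 ^ m))))
  one-step : ∀ m → 6 * walk m (λ a b → potential (nextSize t a b)) ≤ 5 * (2 ^ m * potential m)
  one-step 0 = ≤-trans (*-monoʳ-≤ 6 (small 0 z≤n)) z≤n
  one-step 1 = ≤-trans (*-monoʳ-≤ 6 (small 1 (s≤s z≤n))) z≤n
  one-step 2 = ≤-trans (*-monoʳ-≤ 6 (small 2 ≤-refl)) z≤n
  one-step (suc (suc (suc m))) = ≤-trans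
    (*-monoʳ-≤ 6 (walk-mono (3 + m) (λ a b _ → potential-≤ (nextSize t a b))))
    (walk-nextSize t m)

-- Deletion paths and odd cliques

-- Path a F V W: W arises from V by steps of an even decomposition that delete
-- no vertex of F.  Counting the edges from T to V rather than to V ⊻ T makes no
-- difference because T is independent.
data Path {n} (a : Adj n) (F : VSet n) : VSet n → VSet n → Set where
  stop : ∀ {V W} → (∀ x → V x ≡ W x) → Path a F V W
  step : ∀ {V W} (T : VSet n) → T ⊑ V → (∀ x → T x ≡ true → F x ≡ false) →
         (∀ x y → T x ≡ true → T y ≡ true → a x y ≡ false) → (∃[ x ] T x ≡ true) →
         ⨁ (λ x → T x ∧ deg a V x) ≡ false → Path a F (V ⊻ T) W → Path a F V W

private variable
  a a′ : Adj n
  F F′ O U V W : VSet n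

true≢false : ∀ {A : Set} {b} → b ≡ true → b ≡ false → A
true≢false refl ()

∧-true : ∀ {b c} → b ∧ c ≡ true → b ≡ true × c ≡ true
∧-true {true} {true} _ = refl , refl

≢true⇒false : ∀ {b} → ¬ (b ≡ true) → b ≡ false
≢true⇒false {true}  ¬p = ⊥-elim (¬p refl)
≢true⇒false {false} ¬p = refl

path-cong : (∀ x → V x ≡ W x) → Path a F W U → Path a F V U
path-cong e (stop f) = stop (λ x → trans (e x) (f x))
path-cong {a = a} e (step T T⊑ T∌F ind ne ev p) =
  step T (λ x Tx → trans (e x) (T⊑ x Tx)) T∌F ind ne
       (trans (⨁-cong (λ x → cong (T x ∧_) (deg-cong a e x))) ev)
       (path-cong (λ x → cong (_xor T x) (e x)) p)

path-trans : Path a F V W → Path a F W U → Path a F V U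
path-trans (stop e) q = path-cong e q
path-trans (step T T⊑ T∌F ind ne ev p) q = step T T⊑ T∌F ind ne ev (path-trans p q)

path-weaken : F′ ⊑ F → Path a F V W → Path a F′ V W
path-weaken F′⊑F (stop e) = stop e
path-weaken F′⊑F (step T T⊑ T∌F ind ne ev p) =
  step T T⊑ (λ x Tx → ≢true⇒false (λ F′x → true≢false (F′⊑F x F′x) (T∌F x Tx))) ind ne ev (path-weaken F′⊑F p)

keeps-⊻ : ∀ (T : VSet n) → (∀ x → T x ≡ true → F x ≡ false) → F ⊑ V → F ⊑ (V ⊻ T)
keeps-⊻ T T∌F F⊑V x Fx with T x in Tx
... | true  = true≢false Fx (T∌F x Tx)
... | false = trans (Boolₚ.xor-identityʳ _) (F⊑V x Fx)

path-keeps : Path a F V W → F ⊑ V → F ⊑ W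
path-keeps (stop e) F⊑V x Fx = trans (sym (e x)) (F⊑V x Fx)
path-keeps (step T T⊑ T∌F ind ne ev p) F⊑V = path-keeps p (keeps-⊻ T T∌F F⊑V)

⊻-⊑ : ∀ (T : VSet n) → T ⊑ V → (V ⊻ T) ⊑ V
⊻-⊑ {V = V} T T⊑V x VTx with T x in Tx
... | true  = T⊑V x Tx
... | false = trans (sym (Boolₚ.xor-identityʳ (V x))) VTx

path-⊑ : Path a F V W → W ⊑ V
path-⊑ (stop e) x Wx = trans (e x) Wx
path-⊑ (step T T⊑ T∌F ind ne ev p) x Wx = ⊻-⊑ T T⊑ x (path-⊑ p x Wx)

-- A step loses the edges inside `T`, of which there are none, and an even number of edges from `T`
-- to the rest.
path-edgeParity : ∀ {t : Tri n} → Path (adj t) F V W → edgeParity t V ≡ edgeParity t W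
path-edgeParity {t = t} (stop e) = edgeParity-cong t e
path-edgeParity {V = V} {W} {t} (step T T⊑ T∌F ind ne ev p) = begin
  edgeParity t V                                        ≡⟨ sym (Boolₚ.xor-identityʳ _) ⟩
  edgeParity t V xor false                              ≡⟨ sym (Boolₚ.xor-identityʳ _) ⟩
  (edgeParity t V xor false) xor false                  ≡⟨ cong₂ (λ b c → (edgeParity t V xor b) xor c) (sym (edgeParity-independent t T ind)) (sym ev) ⟩
  (edgeParity t V xor edgeParity t T) xor ⨁ (λ x → T x ∧ deg (adj t) V x) ≡⟨ sym (edgeParity-⊻ t V T) ⟩
  edgeParity t (V ⊻ T)                                  ≡⟨ path-edgeParity p ⟩
  edgeParity t W                                        ∎
  where open ≡-Reasoning

-- What deletions outside `F` depend on while all of `F` is present. Edges inside `F` may differ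
-- freely.
Agree : VSet n → Adj n → Adj n → Set
Agree F a a′ = (∀ x y → F x ≡ false → F y ≡ false → a x y ≡ a′ x y) ×
               (∀ x → F x ≡ false → deg a F x ≡ deg a′ F x)

-- Since `F ⊑ V`, the set `V ⊻ F` is `V` without `F`. The two graphs have the same edges from `x` to
-- that part, and equally many modulo 2 to `F`.
agree-deg : Agree F a a′ → F ⊑ V → ∀ x → F x ≡ false → deg a V x ≡ deg a′ V x
agree-deg {F = F} {a} {a′} {V} (out , par) F⊑V x Fx = begin
  deg a V x                         ≡⟨ split a ⟩
  deg a F x xor deg a (V ⊻ F) x     ≡⟨ cong₂ _xor_ (par x Fx) (⨁-cong rest) ⟩
  deg a′ F x xor deg a′ (V ⊻ F) x   ≡⟨ sym (split a′) ⟩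
  deg a′ V x                        ∎
  where
  open ≡-Reasoning
  cancel : ∀ b c → b ≡ c xor (b xor c)
  cancel true  true  = refl
  cancel true  false = refl
  cancel false true  = refl
  cancel false false = refl
  split : ∀ a → deg a V x ≡ deg a F x xor deg a (V ⊻ F) x
  split a = trans (deg-cong a (λ y → cancel (V y) (F y)) x) (deg-⊻ a F (V ⊻ F) x)
  rest : ∀ y → (V ⊻ F) y ∧ a x y ≡ (V ⊻ F) y ∧ a′ x y
  rest y with F y in Fy
  ... | true  rewrite F⊑V y Fy = refl
  ... | false = cong ((V y xor false) ∧_) (out x y Fx Fy)

-- Independence of a deleted set concerns only edges outside `F`, and evenness only degree parities
-- outside `F`; as `F` itself is never touched, the same deletions are legal in both graphs.
path-agree : Agree F a a′ → F ⊑ V → Path a F V W → Path a′ F V W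
path-agree ag F⊑V (stop e) = stop e
path-agree {F = F} {a} {a′} {V} ag F⊑V (step T T⊑ T∌F ind ne ev p) =
  step T T⊑ T∌F (λ x y Tx Ty → trans (sym (proj₁ ag x y (T∌F x Tx) (T∌F y Ty))) (ind x y Tx Ty)) ne
       (trans (⨁-cong even) ev) (path-agree ag (keeps-⊻ T T∌F F⊑V) p)
  where
  even : ∀ x → T x ∧ deg a′ V x ≡ T x ∧ deg a V x
  even x with T x in Tx
  ... | false = refl
  ... | true  = sym (agree-deg {a = a} {a′} ag F⊑V x (T∌F x Tx))

remove-even : ∀ c → V c ≡ true → F c ≡ false → a c c ≡ false → deg a V c ≡ false →
              Path a F (V ⊻ δ c) W → Path a F V W
remove-even {V = V} {F} {a} c Vc Fc acc dc = step (δ c)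
  (λ x e → subst (λ z → V z ≡ true) (δ-true e) Vc)
  (λ x e → subst (λ z → F z ≡ false) (δ-true e) Fc)
  (λ x y e f → subst₂ (λ z w → a z w ≡ false) (δ-true e) (δ-true f) acc)
  (c , δ-refl c) (trans (⨁-δ c (deg a V)) dc)

δδ-cases : ∀ {c d : Fin n} x → (δ c ⊻ δ d) x ≡ true → (P : Fin n → Set) → P c → P d → P x
δδ-cases {c = c} {d} x e P pc pd with c Finₚ.≟ x | d Finₚ.≟ x
... | yes refl | _        = pc
... | no _     | yes refl = pd
... | no _     | no _     with () ← e

remove-odd-pair : ∀ c d → c ≢ d → V c ≡ true → V d ≡ true → F c ≡ false → F d ≡ false →
  (∀ x y → a x y ≡ a y x) → (∀ x → a x x ≡ false) → a c d ≡ false →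
  deg a V c ≡ true → deg a V d ≡ true →
  Path a F (V ⊻ (δ c ⊻ δ d)) W → Path a F V W
remove-odd-pair {V = V} {F} {a} c d c≢d Vc Vd Fc Fd sy ir acd dc dd = step (δ c ⊻ δ d)
  (λ x e → δδ-cases x e (λ z → V z ≡ true) Vc Vd)
  (λ x e → δδ-cases x e (λ z → F z ≡ false) Fc Fd)
  (λ x y e f → δδ-cases x e (λ z → a z y ≡ false)
     (δδ-cases y f (λ w → a c w ≡ false) (ir c) acd)
     (δδ-cases y f (λ w → a d w ≡ false) (trans (sy d c) acd) (ir d)))
  (c , cong₂ _xor_ (δ-refl c) (δ-≢ (c≢d ∘ sym)))
  (begin
    ⨁ (λ x → (δ c ⊻ δ d) x ∧ deg a V x)
      ≡⟨ ⨁-cong (λ x → Boolₚ.∧-distribʳ-xor (deg a V x) (δ c x) (δ d x)) ⟩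
    ⨁ (λ x → (δ c x ∧ deg a V x) xor (δ d x ∧ deg a V x))
      ≡⟨ ⨁-xor (λ x → δ c x ∧ deg a V x) _ ⟩
    ⨁ (λ x → δ c x ∧ deg a V x) xor ⨁ (λ x → δ d x ∧ deg a V x)
      ≡⟨ cong₂ _xor_ (trans (⨁-δ c (deg a V)) dc) (trans (⨁-δ d (deg a V)) dd) ⟩
    false ∎)
  where open ≡-Reasoning

-- Cliques of odd vertices

Clique : Adj n → VSet n → VSet n → Set
Clique a O V = ∀ x y → O x ≡ true → O y ≡ true → V x ≡ true → V y ≡ true → x ≢ y → a x y ≡ true

record OddClique (a : Adj n) (O V : VSet n) : Set where
  constructor oddClique
  field
    clique : Clique a O V
    allOdd : ∀ x → O x ≡ true → V x ≡ true → deg a V x ≡ true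

agree-oddClique : Agree F a a′ → (∀ x → O x ≡ true → F x ≡ false) → F ⊑ V → OddClique a O V → OddClique a′ O V
agree-oddClique {a = a} {a′} ag O∌F F⊑V (oddClique cl od) = oddClique
  (λ x y Ox Oy Vx Vy x≢y → trans (sym (proj₁ ag x y (O∌F x Ox) (O∌F y Oy))) (cl x y Ox Oy Vx Vy x≢y))
  (λ x Ox Vx → trans (sym (agree-deg {a = a} {a′} ag F⊑V x (O∌F x Ox))) (od x Ox Vx))

agree-sym : Agree F a a′ → Agree F a′ a
agree-sym (out , par) = (λ x y Fx Fy → sym (out x y Fx Fy)) , (λ x Fx → sym (par x Fx))

∣_∩_∣ : VSet n → VSet n → ℕ
∣ O ∩ V ∣ = # (λ x → O x ∧ V x)

clique-⊑ : W ⊑ V → Clique a O V → Clique a O W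
clique-⊑ W⊑V cl x y Ox Oy Wx Wy = cl x y Ox Oy (W⊑V x Wx) (W⊑V y Wy)

delete-self : ∀ {V : VSet n} c → V c ≡ true → (V ⊻ δ c) c ≡ false
delete-self c Vc = cong₂ _xor_ Vc (δ-refl c)

delete-other : ∀ {V : VSet n} {c x} → c ≢ x → (V ⊻ δ c) x ≡ V x
delete-other {V = V} {x = x} c≢x = trans (cong (V x xor_) (δ-≢ c≢x)) (Boolₚ.xor-identityʳ (V x))

deg-delete : ∀ (a : Adj n) V c x → deg a (V ⊻ δ c) x ≡ deg a V x xor a x c
deg-delete a V c x = trans (deg-⊻ a V (δ c) x) (cong (deg a V x xor_) (deg-δ a c x))

xor-trueʳ : ∀ b → b xor true ≡ not b
xor-trueʳ true  = refl
xor-trueʳ false = refl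

evens odds : Adj n → VSet n → VSet n → ℕ
evens a O V = # (λ x → (O x ∧ V x) ∧ not (deg a V x))
odds  a O V = # (λ x → (O x ∧ V x) ∧ deg a V x)

evens+odds : ∀ (a : Adj n) O V → evens a O V + odds a O V ≡ ∣ O ∩ V ∣
evens+odds a O V = trans (+-comm (evens a O V) _) (#-∧-not (λ x → O x ∧ V x) (deg a V))

∧-delete : ∀ {O V : VSet n} {c x} → c ≢ x → O x ∧ (V ⊻ δ c) x ≡ O x ∧ V x
∧-delete {O = O} {V} {c} {x} c≢x = cong (O x ∧_) (delete-other {V = V} c≢x)

deg-delete-clique : ∀ {c x} → Clique a O V → O c ≡ true → V c ≡ true → c ≢ x → O x ∧ V x ≡ true →
                    deg a (V ⊻ δ c) x ≡ not (deg a V x)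
deg-delete-clique {a = a} {V = V} {c} {x} cl Oc Vc c≢x OVx = begin
  deg a (V ⊻ δ c) x   ≡⟨ deg-delete a V c x ⟩
  deg a V x xor a x c ≡⟨ cong (deg a V x xor_) (cl x c (proj₁ (∧-true OVx)) Oc (proj₂ (∧-true OVx)) Vc (c≢x ∘ sym)) ⟩
  deg a V x xor true  ≡⟨ xor-trueʳ _ ⟩
  not (deg a V x)     ∎
  where open ≡-Reasoning

∧-congʳ-true : ∀ {b c d} → (b ≡ true → c ≡ d) → b ∧ c ≡ b ∧ d
∧-congʳ-true {true}  e = e refl
∧-congʳ-true {false} e = refl

-- All other surviving vertices of `O` are adjacent to `c` and change parity, while `c` itself is
-- gone: the former odd class becomes the even class.
evens-delete : ∀ c → Clique a O V → O c ≡ true → V c ≡ true → deg a V c ≡ false →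
               evens a O (V ⊻ δ c) ≡ odds a O V
evens-delete {a = a} {O} {V} c cl Oc Vc dc = #-cong pointwise
  where
  pointwise : ∀ x → (O x ∧ (V ⊻ δ c) x) ∧ not (deg a (V ⊻ δ c) x) ≡ (O x ∧ V x) ∧ deg a V x
  pointwise x with c Finₚ.≟ x
  ... | yes refl rewrite Oc | Vc | dc = refl
  ... | no c≢x rewrite Boolₚ.xor-identityʳ (V x) = ∧-congʳ-true λ OVx →
    trans (cong not (deg-delete-clique {a = a} {O} {V} cl Oc Vc c≢x OVx)) (Boolₚ.not-involutive _)

odds-delete : ∀ c → Clique a O V → O c ≡ true → V c ≡ true → deg a V c ≡ false →
              evens a O V ≡ suc (odds a O (V ⊻ δ c))
odds-delete {a = a} {O} {V} c cl Oc Vc dc = #-remove c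
  (cong₂ _∧_ (cong₂ _∧_ Oc Vc) (cong not dc))
  (cong (_∧ deg a (V ⊻ δ c) c) (trans (cong (O c ∧_) (delete-self {V = V} c Vc)) (Boolₚ.∧-zeroʳ (O c))))
  (λ x c≢x → trans
    (∧-congʳ-true λ OVx → sym (deg-delete-clique {a = a} {O} {V} cl Oc Vc c≢x OVx))
    (cong (_∧ deg a (V ⊻ δ c) x) (sym (∧-delete {O = O} {V} c≢x))))

-- The two classes exchange roles at every deletion, so the recursion runs on their total `k`. It
-- ends when the even class is empty, and the invariance `residue-swap` carries the bound back
-- through each deletion.
alternate : ∀ k e o → (∀ x → a x x ≡ false) → (∀ x → O x ≡ true → F x ≡ false) → Clique a O V →
  evens a O V ≡ e → odds a O V ≡ o → e + o ≡ k →
  ∃[ W ] Path a F V W × OddClique a O W × ∣ O ∩ W ∣ ≤ residue e o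
alternate {a = a} {O} {V = V} k zero o ir O∌F cl ev od _ =
  V , stop (λ _ → refl) , oddClique cl all-odd , ≤-reflexive (trans (sym (evens+odds a O V)) (trans (cong₂ _+_ ev od) (sym (+-identityʳ o))))
  where
  all-odd : ∀ x → O x ≡ true → V x ≡ true → deg a V x ≡ true
  all-odd x Ox Vx with #≡0⇒false _ ev x
  ... | e rewrite Ox | Vx = Boolₚ.not-injective e
alternate {a = a} {O} {F} {V} (suc k) (suc e) o ir O∌F cl ev od size
  with c , cEven ← #>0⇒∃ _ (subst (0 <_) (sym ev) (s≤s z≤n))
  with OVc , ndc ← ∧-true cEven
  with Oc , Vc ← ∧-true OVc
  with dc ← Boolₚ.not-injective {y = false} ndc
  with W , p , oc , le ← alternate {a = a} {O} {F} {V ⊻ δ c} k o e ir O∌F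
         (clique-⊑ {a = a} (⊻-⊑ {V = V} (δ c) (λ x e → subst (λ z → V z ≡ true) (δ-true e) Vc)) cl)
         (trans (evens-delete {a = a} {O} {V} c cl Oc Vc dc) od)
         (suc-injective (trans (sym (odds-delete {a = a} {O} {V} c cl Oc Vc dc)) ev))
         (trans (+-comm o e) (suc-injective size))
  = W , remove-even c Vc (O∌F c Oc) (ir c) dc p , oc , ≤-trans le (≤-reflexive (sym (residue-swap e o)))

-- The part of the degree parity of `q` that toggling edges between `q` and `O` leaves alone.
outsideParity : Adj n → VSet n → VSet n → Fin n → Bool
outsideParity a O V q = ⨁ (λ y → (not (O y) ∧ V y) ∧ a q y)

deg-outer : ∀ (a : Adj n) O V q → deg a V q ≡ odd (# (λ x → (O x ∧ V x) ∧ a q x)) xor outsideParity a O V q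
deg-outer a O V q = begin
  ⨁ (λ y → V y ∧ a q y)
    ≡⟨ ⨁-cong (λ y → split (O y) (V y) (a q y)) ⟩
  ⨁ (λ y → ((O y ∧ V y) ∧ a q y) xor ((not (O y) ∧ V y) ∧ a q y))
    ≡⟨ ⨁-xor (λ y → (O y ∧ V y) ∧ a q y) _ ⟩
  ⨁ (λ y → (O y ∧ V y) ∧ a q y) xor outsideParity a O V q
    ≡⟨ cong (_xor outsideParity a O V q) (⨁-odd (λ y → (O y ∧ V y) ∧ a q y)) ⟩
  odd (# (λ x → (O x ∧ V x) ∧ a q x)) xor outsideParity a O V q ∎
  where
  open ≡-Reasoning
  split : ∀ o v b → v ∧ b ≡ ((o ∧ v) ∧ b) xor ((not o ∧ v) ∧ b)
  split true  v b = sym (Boolₚ.xor-identityʳ (v ∧ b))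
  split false v b = refl

-- All clique vertices are odd beforehand, so deleting `q` makes exactly its neighbours among them
-- even; these form the even class from which `alternate` starts.
use-vertex : ∀ q → (∀ x y → a x y ≡ a y x) → (∀ x → a x x ≡ false) → (∀ x → O x ≡ true → F x ≡ false) →
  F q ≡ false → O q ≡ false → V q ≡ true → OddClique a O V →
  ∃[ W ] Path a F V W × OddClique a O W ×
    ∣ O ∩ W ∣ ≤ nextSize (outsideParity a O V q) (# (λ x → (O x ∧ V x) ∧ a q x)) (# (λ x → (O x ∧ V x) ∧ not (a q x)))
use-vertex {a = a} {O} {F} {V} q sy ir O∌F Fq Oq Vq (oddClique cl od)
  with odd (# (λ x → (O x ∧ V x) ∧ a q x)) xor outsideParity a O V q in parity
... | true  = V , stop (λ _ → refl) , oddClique cl od , ≤-reflexive (sym (#-∧-not (λ x → O x ∧ V x) (a q)))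
... | false
  with W , p , oc , le ← alternate {a = a} {O} {F} {V ⊻ δ q} _ _ _ ir O∌F
         (clique-⊑ {a = a} (⊻-⊑ (δ q) (λ x e → subst (λ z → V z ≡ true) (δ-true e) Vq)) cl) refl refl refl
  = W , remove-even q Vq Fq (ir q) (trans (deg-outer a O V q) parity) p , oc ,
    ≤-trans le (≤-reflexive (cong₂ residue (#-cong evens≗) (#-cong odds≗)))
  where
  O∧V≗ : ∀ x → O x ∧ (V ⊻ δ q) x ≡ O x ∧ V x
  O∧V≗ x with q Finₚ.≟ x
  ... | yes refl rewrite Oq = refl
  ... | no _ = cong (O x ∧_) (Boolₚ.xor-identityʳ (V x))
  deg≗ : ∀ x → O x ∧ V x ≡ true → deg a (V ⊻ δ q) x ≡ not (a q x)
  deg≗ x OVx = trans (deg-delete a V q x) (cong₂ _xor_ (od x (proj₁ (∧-true OVx)) (proj₂ (∧-true OVx))) (sy x q))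
  evens≗ : ∀ x → (O x ∧ (V ⊻ δ q) x) ∧ not (deg a (V ⊻ δ q) x) ≡ (O x ∧ V x) ∧ a q x
  evens≗ x = trans (cong (_∧ not (deg a (V ⊻ δ q) x)) (O∧V≗ x))
    (∧-congʳ-true λ OVx → trans (cong not (deg≗ x OVx)) (Boolₚ.not-involutive _))
  odds≗ : ∀ x → (O x ∧ (V ⊻ δ q) x) ∧ deg a (V ⊻ δ q) x ≡ (O x ∧ V x) ∧ not (a q x)
  odds≗ x = trans (cong (_∧ deg a (V ⊻ δ q) x) (O∧V≗ x)) (∧-congʳ-true (deg≗ x))

-- `k` bounds the vertices still available for deletion. When neither kind of deletion applies, the
-- absence of even vertices and the absence of non-adjacent pairs are the two fields of `OddClique`.
greedy : ∀ k → (∀ x y → a x y ≡ a y x) → (∀ x → a x x ≡ false) → ∣ not ∘ F ∩ V ∣ ≤ k →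
         ∃[ W ] Path a F V W × OddClique a (not ∘ F) W
greedy {n} {a} {F} {V} k sy ir size
  with Finₚ.any? (λ x → (F x Boolₚ.≟ false) ×-dec (V x Boolₚ.≟ true) ×-dec (deg a V x Boolₚ.≟ false))
greedy {a = a} {F} {V} zero sy ir size | yes (c , Fc , Vc , dc)
  with () ← ≤-trans (#-strict {f = λ _ → false} {λ x → not (F x) ∧ V x} c (λ _ ()) refl (cong₂ _∧_ (cong not Fc) Vc)) size
greedy {a = a} {F} {V} (suc k) sy ir size | yes (c , Fc , Vc , dc)
  with W , p , oc ← greedy {a = a} {F} {V ⊻ δ c} k sy ir (s≤s⁻¹ (≤-trans (#-strict c
         (λ x e → cong₂ _∧_ (proj₁ (∧-true e)) (⊻-⊑ (δ c) (λ y e → subst (λ z → V z ≡ true) (δ-true e) Vc) x (proj₂ (∧-true e))))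
         (trans (cong (not (F c) ∧_) (delete-self {V = V} c Vc)) (Boolₚ.∧-zeroʳ _))
         (cong₂ _∧_ (cong not Fc) Vc)) size))
  = W , remove-even c Vc Fc (ir c) dc p , oc
greedy {n} {a} {F} {V} k sy ir size | no no-even
  with Finₚ.any? (λ c → (F c Boolₚ.≟ false) ×-dec (V c Boolₚ.≟ true) ×-dec
         Finₚ.any? (λ d → (F d Boolₚ.≟ false) ×-dec (V d Boolₚ.≟ true) ×-dec (¬? (c Finₚ.≟ d)) ×-dec (a c d Boolₚ.≟ false)))
... | no no-pair = V , stop (λ _ → refl) , oddClique
  (λ x y Ox Oy Vx Vy x≢y → ≢false⇒true λ axy → no-pair (x , Boolₚ.not-injective Ox , Vx , y , Boolₚ.not-injective Oy , Vy , x≢y , axy))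
  (λ x Ox Vx → ≢false⇒true λ dx → no-even (x , Boolₚ.not-injective Ox , Vx , dx))
  where
  ≢false⇒true : ∀ {b} → ¬ (b ≡ false) → b ≡ true
  ≢false⇒true {true}  _ = refl
  ≢false⇒true {false} ¬p = ⊥-elim (¬p refl)
greedy {a = a} {F} {V} zero sy ir size | no no-even | yes (c , Fc , Vc , _)
  with () ← ≤-trans (#-strict {f = λ _ → false} {λ x → not (F x) ∧ V x} c (λ _ ()) refl (cong₂ _∧_ (cong not Fc) Vc)) size
greedy {a = a} {F} {V} (suc k) sy ir size | no no-even | yes (c , Fc , Vc , d , Fd , Vd , c≢d , acd)
  with W , p , oc ← greedy {a = a} {F} {V ⊻ (δ c ⊻ δ d)} k sy ir (s≤s⁻¹ (≤-trans (#-strict c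
         (λ x e → cong₂ _∧_ (proj₁ (∧-true e)) (⊻-⊑ (δ c ⊻ δ d) (λ y e → δδ-cases y e (λ z → V z ≡ true) Vc Vd) x (proj₂ (∧-true e))))
         (trans (cong (not (F c) ∧_) (cong₂ _xor_ Vc (cong₂ _xor_ (δ-refl c) (δ-≢ (c≢d ∘ sym))))) (Boolₚ.∧-zeroʳ _))
         (cong₂ _∧_ (cong not Fc) Vc)) size))
  = W , remove-odd-pair c d c≢d Vc Vd Fc Fd sy ir acd (odd-at c Fc Vc) (odd-at d Fd Vd) p , oc
  where
  odd-at : ∀ x → F x ≡ false → V x ≡ true → deg a V x ≡ true
  odd-at x Fx Vx with deg a V x in e
  ... | true  = refl
  ... | false = ⊥-elim (no-even (x , Fx , Vx , e))

-- Toggling edges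

-- One orientation of the toggled edges. `flip` symmetrises it with `_xor_`, which also clears the
-- diagonal.
arc : VSet n → Fin n → Fin n → Vec Bool n → Adj n
arc O q z y i j = (O i ∧ lookup y i) ∧ (δ q j xor δ z j)

-- Toggling the edges from q to the part of O selected by y; toggling the edges
-- from z to the same vertices keeps all degree parities in O.
flip : VSet n → Fin n → Fin n → Vec Bool n → Tri n → Tri n
flip O q z y t = t ⊕ triangle (λ i j → arc O q z y i j xor arc O q z y j i)

module _ (O : VSet n) (q z : Fin n) (y : Vec Bool n) (t : Tri n) where

  private
    t′ = flip O q z y t

  adj-flip : ∀ i j → adj t′ i j ≡ adj t i j xor (arc O q z y i j xor arc O q z y j i)
  adj-flip i j = trans (adj-⊕ t _ i j) (cong (adj t i j xor_)
    (adj-triangle _ (λ i j → Boolₚ.xor-comm (arc O q z y i j) _) (λ i → Boolₚ.xor-same (arc O q z y i i)) i j))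

  arc-∉O : ∀ i j → O i ≡ false → arc O q z y i j ≡ false
  arc-∉O i j Oi rewrite Oi = refl

  arc-≢ : ∀ i j → q ≢ j → z ≢ j → arc O q z y i j ≡ false
  arc-≢ i j q≢j z≢j = trans (cong₂ (λ b c → (O i ∧ lookup y i) ∧ (b xor c)) (δ-≢ q≢j) (δ-≢ z≢j)) (Boolₚ.∧-zeroʳ _)

  flip-∉O : ∀ i j → O i ≡ false → O j ≡ false → adj t′ i j ≡ adj t i j
  flip-∉O i j Oi Oj = trans (adj-flip i j) (trans
    (cong₂ (λ b c → adj t i j xor (b xor c)) (arc-∉O i j Oi) (arc-∉O j i Oj)) (Boolₚ.xor-identityʳ _))

  flip-≢ : ∀ i j → q ≢ i → z ≢ i → q ≢ j → z ≢ j → adj t′ i j ≡ adj t i j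
  flip-≢ i j qi zi qj zj = trans (adj-flip i j) (trans
    (cong₂ (λ b c → adj t i j xor (b xor c)) (arc-≢ i j qj zj) (arc-≢ j i qi zi)) (Boolₚ.xor-identityʳ _))

  -- As `y` runs over all vectors, the row of `q` on `O` becomes uniform; this is the randomness
  -- that `potential-drift` consumes.
  flip-row : q ≢ z → O q ≡ false → ∀ x → O x ≡ true → adj t′ q x ≡ adj t q x xor lookup y x
  flip-row q≢z Oq x Ox = trans (adj-flip q x) (cong (adj t q x xor_) (begin
    arc O q z y q x xor arc O q z y x q ≡⟨ cong (_xor arc O q z y x q) (arc-∉O q x Oq) ⟩
    (O x ∧ lookup y x) ∧ (δ q q xor δ z q)
      ≡⟨ cong₂ (λ b c → (b ∧ lookup y x) ∧ c) Ox (cong₂ _xor_ (δ-refl q) (δ-≢ (q≢z ∘ sym))) ⟩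
    lookup y x ∧ true                   ≡⟨ Boolₚ.∧-identityʳ _ ⟩
    lookup y x                          ∎))
    where open ≡-Reasoning

  flip-outer : O q ≡ false → ∀ V → outsideParity (adj t′) O V q ≡ outsideParity (adj t) O V q
  flip-outer Oq V = ⨁-cong λ x → ∧-congʳ-true λ e → flip-∉O q x Oq (Boolₚ.not-injective (proj₁ (∧-true e)))

  flip-agree : ∀ {F} → (∀ x → O x ≡ true → F x ≡ false) → F q ≡ true → F z ≡ true → Agree F (adj t) (adj t′)
  flip-agree {F} O∌F Fq Fz = (λ i j Fi Fj → sym (flip-≢ i j (apart Fq Fi) (apart Fz Fi) (apart Fq Fj) (apart Fz Fj))) , same-deg
    where
    apart : ∀ {u v} → F u ≡ true → F v ≡ false → u ≢ v
    apart Fu Fv refl = true≢false Fu Fv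
    same-deg : ∀ x → F x ≡ false → deg (adj t) F x ≡ deg (adj t′) F x
    same-deg x Fx = sym (begin
      ⨁ (λ w → F w ∧ adj t′ x w)
        ≡⟨ ⨁-cong (λ w → ∧-congʳ-true λ Fw → trans (adj-flip x w)
             (cong (λ b → adj t x w xor (arc O q z y x w xor b)) (arc-∉O w x (≢true⇒false λ Ow → true≢false Fw (O∌F w Ow))))) ⟩
      ⨁ (λ w → F w ∧ (adj t x w xor (arc O q z y x w xor false)))
        ≡⟨ ⨁-cong (λ w → distribute (F w) (adj t x w) (O x ∧ lookup y x) (δ q w) (δ z w)) ⟩
      ⨁ (λ w → (F w ∧ adj t x w) xor ((O x ∧ lookup y x) ∧ ((δ q w ∧ F w) xor (δ z w ∧ F w))))
        ≡⟨ ⨁-xor (λ w → F w ∧ adj t x w) _ ⟩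
      deg (adj t) F x xor ⨁ (λ w → (O x ∧ lookup y x) ∧ ((δ q w ∧ F w) xor (δ z w ∧ F w)))
        ≡⟨ cong (deg (adj t) F x xor_) (trans (⨁-∧ (O x ∧ lookup y x) (λ w → (δ q w ∧ F w) xor (δ z w ∧ F w))) (cong ((O x ∧ lookup y x) ∧_) even)) ⟩
      deg (adj t) F x xor ((O x ∧ lookup y x) ∧ false)
        ≡⟨ cong (deg (adj t) F x xor_) (Boolₚ.∧-zeroʳ _) ⟩
      deg (adj t) F x xor false
        ≡⟨ Boolₚ.xor-identityʳ _ ⟩
      deg (adj t) F x ∎)
      where
      open ≡-Reasoning
      even : ⨁ (λ w → (δ q w ∧ F w) xor (δ z w ∧ F w)) ≡ false
      even = trans (⨁-xor (λ w → δ q w ∧ F w) _)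
                   (cong₂ _xor_ (trans (⨁-δ q F) Fq) (trans (⨁-δ z F) Fz))
      distribute : ∀ f a o b c → f ∧ (a xor ((o ∧ (b xor c)) xor false)) ≡ (f ∧ a) xor (o ∧ ((b ∧ f) xor (c ∧ f)))
      distribute true  a o b c rewrite Boolₚ.∧-identityʳ b | Boolₚ.∧-identityʳ c = cong (a xor_) (Boolₚ.xor-identityʳ _)
      distribute false a o b c rewrite Boolₚ.∧-zeroʳ b | Boolₚ.∧-zeroʳ c = sym (Boolₚ.∧-zeroʳ o)

-- Averages over toggles

sumFlips : VSet n → Fin n → List (Fin n) → (Tri n → ℕ) → Tri n → ℕ
sumFlips O z []      f t = f t
sumFlips O z (q ∷ Q) f t = ∑ (vecs _) (λ y → sumFlips O z Q f (flip O q z y t))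

∑-sumFlips : ∀ (O : VSet n) z Q f → ∑ (tris n) (sumFlips O z Q f) ≡ (2 ^ n) ^ length Q * ∑ (tris n) f
∑-sumFlips     O z []      f = sym (+-identityʳ _)
∑-sumFlips {n} O z (q ∷ Q) f = begin
  ∑ (tris n) (λ t → ∑ (vecs n) (λ y → sumFlips O z Q f (flip O q z y t)))
    ≡⟨ ∑-comm (tris n) (vecs n) _ ⟩
  ∑ (vecs n) (λ y → ∑ (tris n) (λ t → sumFlips O z Q f (flip O q z y t)))
    ≡⟨ ∑-cong (vecs n) (λ y → ∑-tris-⊕ _ (sumFlips O z Q f)) ⟩
  ∑ (vecs n) (λ y → ∑ (tris n) (sumFlips O z Q f))
    ≡⟨ trans (∑-const (vecs n) _) (cong₂ _*_ (length-vecs n) (∑-sumFlips O z Q f)) ⟩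
  2 ^ n * ((2 ^ n) ^ length Q * ∑ (tris n) f)
    ≡⟨ sym (*-assoc (2 ^ n) _ _) ⟩
  (2 ^ n) ^ length (q ∷ Q) * ∑ (tris n) f ∎
  where open ≡-Reasoning

-- An event preserved by all the toggles acts as a constant, as under a conditional expectation.
-- This makes it possible to condition on it.
sumFlips-weight : ∀ (O : VSet n) z Q (w f : Tri n → ℕ) → All (λ q → ∀ y t → w (flip O q z y t) ≡ w t) Q →
                  ∀ t → sumFlips O z Q (λ t → w t * f t) t ≡ w t * sumFlips O z Q f t
sumFlips-weight O z []      w f []       t = refl
sumFlips-weight {n} O z (q ∷ Q) w f (e ∷ es) t = trans
  (∑-cong (vecs n) (λ y → trans (sumFlips-weight O z Q w f es (flip O q z y t)) (cong (_* sumFlips O z Q f (flip O q z y t)) (e y t))))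
  (sym (*-distribˡ-∑ (w t) (vecs n) _))

potential-mono : ∀ {a b} → a ≤ b → potential a ≤ potential b
potential-mono {0} _ = z≤n
potential-mono {1} _ = z≤n
potential-mono {2} _ = z≤n
potential-mono {suc (suc (suc a))} (s≤s (s≤s (s≤s p))) = s≤s (s≤s (s≤s p))

bit≤potential : ∀ b m → (m ≤ 2 → b ≡ false) → bit b ≤ potential m
bit≤potential b 0 e rewrite e z≤n = z≤n
bit≤potential b 1 e rewrite e (s≤s z≤n) = z≤n
bit≤potential b 2 e rewrite e ≤-refl = z≤n
bit≤potential b (suc (suc (suc m))) e = ≤-trans (bit≤1 b) (s≤s z≤n)

everything : VSet n
everything _ = true

^-distribʳ-* : ∀ r a b → (a * b) ^ r ≡ a ^ r * b ^ r
^-distribʳ-* zero    a b = refl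
^-distribʳ-* (suc r) a b = trans (cong (a * b *_) (^-distribʳ-* r a b)) (*-interchange a b (a ^ r) (b ^ r))

-- (5/6)⁴ ≤ 1/2.
2^r*5^4r≤6^4r : ∀ r → 2 ^ r * 5 ^ (4 * r) ≤ 6 ^ (4 * r)
2^r*5^4r≤6^4r r = begin
  2 ^ r * 5 ^ (4 * r)   ≡⟨ cong (2 ^ r *_) (sym (^-*-assoc 5 4 r)) ⟩
  2 ^ r * (5 ^ 4) ^ r   ≡⟨ sym (^-distribʳ-* r 2 (5 ^ 4)) ⟩
  (2 * 5 ^ 4) ^ r       ≤⟨ ^-monoˡ-≤ r (≤ᵇ⇒≤ (2 * 5 ^ 4) (6 ^ 4) _) ⟩
  (6 ^ 4) ^ r           ≡⟨ ^-*-assoc 6 4 r ⟩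
  6 ^ (4 * r)           ∎
  where open ≤-Reasoning

-- `O` is the part to be worn down, `z` the common partner of all toggles, and `F₀` the set that no
-- deletion may touch to the very end. The event `bad` is arbitrary as long as reducing the clique
-- to two vertices excludes it, so that both rounds are instances.
module Elimination (O : VSet n) (z : Fin n) (F₀ : VSet n) (bad : Tri n → Bool)
  (good : ∀ t W → Path (adj t) F₀ everything W → OddClique (adj t) O W → ∣ O ∩ W ∣ ≤ 2 → bad t ≡ false) where

  -- A supermartingale bound with denominators cleared. The set `F` holds `z` and the vertices of
  -- `Q` not yet used. While `q` is in `F`, toggling at `q` preserves the whole history of
  -- deletions; then `q` is used and leaves `F`, and the potential drops by 5/6 on average.
  few-bad : ∀ Q F V t → (∀ x → O x ≡ true → F x ≡ false) → F z ≡ true →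
    All (λ q → F q ≡ true × F₀ q ≡ false) Q → All (z ≢_) Q → Unique Q → F₀ ⊑ F →
    Path (adj t) F everything V → OddClique (adj t) O V →
    6 ^ length Q * sumFlips O z Q (bit ∘ bad) t ≤ 5 ^ length Q * ((2 ^ n) ^ length Q * potential ∣ O ∩ V ∣)
  few-bad [] F V t O∌F Fz _ _ _ F₀⊑F path oc = +-monoˡ-≤ 0 (≤-trans
    (bit≤potential (bad t) ∣ O ∩ V ∣ (good t V (path-weaken F₀⊑F path) oc))
    (≤-reflexive (sym (+-identityʳ _))))
  few-bad (q ∷ Q) F V t O∌F Fz ((Fq , F₀q) ∷ Q∈F) (z≢q ∷ z∉Q) (q∉Q ∷ uniq) F₀⊑F path oc = begin
    6 * 6 ^ k * ∑ (vecs n) S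
      ≡⟨ trans (*-assoc 6 (6 ^ k) _) (cong (6 *_) (*-distribˡ-∑ (6 ^ k) (vecs n) S)) ⟩
    6 * ∑ (vecs n) (λ y → 6 ^ k * S y)
      ≤⟨ *-monoʳ-≤ 6 (∑-mono (vecs n) after) ⟩
    6 * ∑ (vecs n) (λ y → 5 ^ k * (X * next y))
      ≡⟨ cong (6 *_) (trans (∑-cong (vecs n) (λ y → sym (*-assoc (5 ^ k) X (next y)))) (sym (*-distribˡ-∑ (5 ^ k * X) (vecs n) next))) ⟩
    6 * (5 ^ k * X * ∑ (vecs n) next)
      ≡⟨ swap (5 ^ k * X) (∑ (vecs n) next) ⟩
    5 ^ k * X * (6 * ∑ (vecs n) next)
      ≤⟨ *-monoʳ-≤ (5 ^ k * X) (potential-drift (outsideParity (adj t) O V q) (λ x → O x ∧ V x) (adj t q)) ⟩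
    5 ^ k * X * (5 * (2 ^ n * potential ∣ O ∩ V ∣))
      ≡⟨ assemble (5 ^ k) X (2 ^ n) (potential ∣ O ∩ V ∣) ⟩
    5 * 5 ^ k * (2 ^ n * X * potential ∣ O ∩ V ∣) ∎
    where
    open ≤-Reasoning
    k = length Q
    X = (2 ^ n) ^ k
    S : Vec Bool n → ℕ
    S y = sumFlips O z Q (bit ∘ bad) (flip O q z y t)
    next : Vec Bool n → ℕ
    next y = potential (nextSize (outsideParity (adj t) O V q)
      (# (λ x → (O x ∧ V x) ∧ (adj t q x xor lookup y x)))
      (# (λ x → (O x ∧ V x) ∧ not (adj t q x xor lookup y x))))
    swap : ∀ a b → 6 * (a * b) ≡ a * (6 * b)
    swap = solve-∀
    assemble : ∀ a x b c → a * x * (5 * (b * c)) ≡ 5 * a * (b * x * c)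
    assemble = solve-∀
    F⊑V : F ⊑ V
    F⊑V = path-keeps path (λ _ _ → refl)
    Oq : O q ≡ false
    Oq = ≢true⇒false λ Oq → true≢false Fq (O∌F q Oq)
    F₁ : VSet n
    F₁ x = F x ∧ not (δ q x)
    F₁⊑F : F₁ ⊑ F
    F₁⊑F x e = proj₁ (∧-true e)
    F₁-≢ : ∀ {x} → F x ≡ true → q ≢ x → F₁ x ≡ true
    F₁-≢ Fx q≢x = cong₂ _∧_ Fx (cong not (δ-≢ q≢x))
    after : ∀ y → 6 ^ k * S y ≤ 5 ^ k * (X * next y)
    after y
      with t′ ← flip O q z y t in t′≡
      with W , p , oc′ , le ← use-vertex {a = adj t′} {O} {F₁} {V} q (adj-sym t′) (adj-irrefl t′)
             (λ x Ox → cong (_∧ not (δ q x)) (O∌F x Ox))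
             (trans (cong₂ (λ b c → b ∧ not c) Fq (δ-refl q)) refl) Oq (F⊑V q Fq)
             (subst (λ t → OddClique (adj t) O V) t′≡ (agree-oddClique {a = adj t} (flip-agree O q z y t O∌F Fq Fz) O∌F F⊑V oc))
      = begin
      6 ^ k * sumFlips O z Q (bit ∘ bad) t′
        ≤⟨ few-bad Q F₁ W t′ (λ x Ox → cong (_∧ not (δ q x)) (O∌F x Ox)) (F₁-≢ Fz (z≢q ∘ sym))
             (All.zipWith (λ { (q≢x , Fx , F₀x) → F₁-≢ Fx q≢x , F₀x }) (q∉Q , Q∈F)) z∉Q uniq
             (λ x F₀x → F₁-≢ (F₀⊑F x F₀x) λ { refl → true≢false F₀x F₀q })
             -- The old deletions avoid all of `F`, hence remain legal in the toggled graph; only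
             -- the new ones may delete `q`.
             (path-trans (path-weaken F₁⊑F (path-agree (subst (λ t′ → Agree F (adj t) (adj t′)) t′≡ (flip-agree O q z y t O∌F Fq Fz)) (λ _ _ → refl) path)) p)
             oc′ ⟩
      5 ^ k * (X * potential ∣ O ∩ W ∣)
        ≤⟨ *-monoʳ-≤ (5 ^ k) (*-monoʳ-≤ X (potential-mono (≤-trans le (≤-reflexive (cong₃ nextSize outer≡ size-in size-out))))) ⟩
      5 ^ k * (X * next y) ∎
      where
      cong₃ : ∀ {A B C D : Set} (f : A → B → C → D) {a a′ b b′ c c′} → a ≡ a′ → b ≡ b′ → c ≡ c′ → f a b c ≡ f a′ b′ c′
      cong₃ f refl refl refl = refl
      row : ∀ x → O x ∧ V x ≡ true → adj t′ q x ≡ adj t q x xor lookup y x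
      row x e = subst (λ t′ → adj t′ q x ≡ adj t q x xor lookup y x) t′≡
        (flip-row O q z y t (z≢q ∘ sym) Oq x (proj₁ (∧-true e)))
      outer≡ = subst (λ t′ → outsideParity (adj t′) O V q ≡ outsideParity (adj t) O V q) t′≡ (flip-outer O q z y t Oq V)
      size-in = #-cong (λ x → ∧-congʳ-true (row x))
      size-out = #-cong (λ x → ∧-congʳ-true (λ e → cong not (row x e)))

  few-bad-halving : ∀ r Q F V t → length Q ≡ 4 * r → (∀ x → O x ≡ true → F x ≡ false) → F z ≡ true →
    All (λ q → F q ≡ true × F₀ q ≡ false) Q → All (z ≢_) Q → Unique Q → F₀ ⊑ F →
    Path (adj t) F everything V → OddClique (adj t) O V →
    2 ^ r * sumFlips O z Q (bit ∘ bad) t ≤ (2 ^ n) ^ length Q * ∣ O ∩ V ∣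
  few-bad-halving r Q F V t |Q| O∌F Fz Q∈F z∉Q uniq F₀⊑F path oc =
    *-cancelˡ-≤ (6 ^ (4 * r)) {{m^n≢0 6 (4 * r)}} (begin
      6 ^ (4 * r) * (2 ^ r * S)           ≡⟨ *-swapˡ (6 ^ (4 * r)) (2 ^ r) S ⟩
      2 ^ r * (6 ^ (4 * r) * S)           ≤⟨ *-monoʳ-≤ (2 ^ r) (subst (λ k → 6 ^ k * S ≤ 5 ^ k * (X * potential ∣ O ∩ V ∣)) |Q|
                                               (few-bad Q F V t O∌F Fz Q∈F z∉Q uniq F₀⊑F path oc)) ⟩
      2 ^ r * (5 ^ (4 * r) * (X * potential ∣ O ∩ V ∣))
                                          ≡⟨ sym (*-assoc (2 ^ r) (5 ^ (4 * r)) _) ⟩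
      2 ^ r * 5 ^ (4 * r) * (X * potential ∣ O ∩ V ∣)
                                          ≤⟨ *-mono-≤ (2^r*5^4r≤6^4r r) (*-monoʳ-≤ X (potential-≤ ∣ O ∩ V ∣)) ⟩
      6 ^ (4 * r) * (X * ∣ O ∩ V ∣)       ∎)
    where
    open ≤-Reasoning
    S = sumFlips O z Q (bit ∘ bad) t
    X = (2 ^ n) ^ length Q

  -- Double counting over the orbits of the flips, on which w is constant.
  bad-fraction : ∀ r Q F m (w : Tri n → Bool) → length Q ≡ 4 * r → (∀ x → O x ≡ true → F x ≡ false) → F z ≡ true →
    All (λ q → F q ≡ true × F₀ q ≡ false) Q → All (z ≢_) Q → Unique Q → F₀ ⊑ F →
    All (λ q → ∀ y t → w (flip O q z y t) ≡ w t) Q →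
    (∀ t → w t ≡ true → ∃[ V ] Path (adj t) F everything V × OddClique (adj t) O V × ∣ O ∩ V ∣ ≤ m) →
    2 ^ r * ∑ (tris n) (λ t → bit (w t ∧ bad t)) ≤ m * ∑ (tris n) (bit ∘ w)
  bad-fraction r Q F m w |Q| O∌F Fz Q∈F z∉Q uniq F₀⊑F w-inv init = *-cancelˡ-≤ X {{m^n≢0 (2 ^ n) (length Q) {{m^n≢0 2 n}}}} (begin
    X * (2 ^ r * ∑ (tris n) (λ t → bit (w t ∧ bad t)))
      ≡⟨ *-swapˡ X (2 ^ r) _ ⟩
    2 ^ r * (X * ∑ (tris n) (λ t → bit (w t ∧ bad t)))
      ≡⟨ cong (2 ^ r *_) (sym (∑-sumFlips O z Q _)) ⟩
    2 ^ r * ∑ (tris n) (sumFlips O z Q (λ t → bit (w t ∧ bad t)))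
      ≡⟨ *-distribˡ-∑ (2 ^ r) (tris n) _ ⟩
    ∑ (tris n) (λ t → 2 ^ r * sumFlips O z Q (λ t → bit (w t ∧ bad t)) t)
      ≤⟨ ∑-mono (tris n) orbit ⟩
    ∑ (tris n) (λ t → X * m * bit (w t))
      ≡⟨ trans (sym (*-distribˡ-∑ (X * m) (tris n) _)) (*-assoc X m _) ⟩
    X * (m * ∑ (tris n) (bit ∘ w)) ∎)
    where
    open ≤-Reasoning
    X = (2 ^ n) ^ length Q
    sumFlips-cong : ∀ Q {f g : Tri n → ℕ} → (∀ t → f t ≡ g t) → ∀ t → sumFlips O z Q f t ≡ sumFlips O z Q g t
    sumFlips-cong []      e t = e t
    sumFlips-cong (q ∷ Q) e t = ∑-cong (vecs n) (λ y → sumFlips-cong Q e (flip O q z y t))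
    orbit : ∀ t → 2 ^ r * sumFlips O z Q (λ t → bit (w t ∧ bad t)) t ≤ X * m * bit (w t)
    orbit t rewrite trans (sumFlips-cong Q (λ t → bit-∧ (w t) (bad t)) t)
                          (sumFlips-weight O z Q (bit ∘ w) (bit ∘ bad) (All.map (λ e y t → cong bit (e y t)) w-inv) t)
      with w t in wt
    ... | false = ≤-trans (≤-reflexive (*-zeroʳ (2 ^ r))) z≤n
    ... | true with V , path , oc , le ← init t wt = begin
      2 ^ r * (sumFlips O z Q (bit ∘ bad) t + 0) ≡⟨ cong (2 ^ r *_) (+-identityʳ _) ⟩
      2 ^ r * sumFlips O z Q (bit ∘ bad) t       ≤⟨ few-bad-halving r Q F V t |Q| O∌F Fz Q∈F z∉Q uniq F₀⊑F path oc ⟩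
      X * ∣ O ∩ V ∣                              ≤⟨ *-monoʳ-≤ X le ⟩
      X * m                                      ≡⟨ sym (*-identityʳ (X * m)) ⟩
      X * m * 1                                  ∎

-- Even decompositions of adjacency matrices

toGraph : Tri n → Graph n
toGraph t = tabulate (λ i → tabulate (adj t i))

adjᵇ-toGraph : ∀ (t : Tri n) i j → adjᵇ (toGraph t) i j ≡ adj t i j
adjᵇ-toGraph t i j = trans (cong (λ r → lookup r j) (Vecₚ.lookup∘tabulate (λ i → tabulate (adj t i)) i))
                           (Vecₚ.lookup∘tabulate (adj t i) j)

toGraph-triangle : ∀ (A : Graph n) → IsSimple A → toGraph (triangle (adjᵇ A)) ≡ A
toGraph-triangle A (sy , ir) = trans
  (Vecₚ.tabulate-cong (λ i → trans (Vecₚ.tabulate-cong (adj-triangle (adjᵇ A) sy ir i)) (Vecₚ.tabulate∘lookup (lookup A i))))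
  (Vecₚ.tabulate∘lookup A)

⨁ᴸ : List A → (A → Bool) → Bool
⨁ᴸ []       p = false
⨁ᴸ (x ∷ xs) p = p x xor ⨁ᴸ xs p

odd-filterᵇ : ∀ (p : A → Bool) xs → odd (length (filterᵇ p xs)) ≡ ⨁ᴸ xs p
odd-filterᵇ p []       = refl
odd-filterᵇ p (x ∷ xs) with p x
... | true  = cong not (odd-filterᵇ p xs)
... | false = odd-filterᵇ p xs

⨁ᴸ-++ : ∀ (xs ys : List A) p → ⨁ᴸ (xs ++ ys) p ≡ ⨁ᴸ xs p xor ⨁ᴸ ys p
⨁ᴸ-++ []       ys p = refl
⨁ᴸ-++ (x ∷ xs) ys p = trans (cong (p x xor_) (⨁ᴸ-++ xs ys p)) (sym (Boolₚ.xor-assoc (p x) _ _))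

⨁ᴸ-map : ∀ (g : A → B) xs p → ⨁ᴸ (map g xs) p ≡ ⨁ᴸ xs (p ∘ g)
⨁ᴸ-map g []       p = refl
⨁ᴸ-map g (x ∷ xs) p = cong (p (g x) xor_) (⨁ᴸ-map g xs p)

⨁ᴸ-concatMap : ∀ (g : A → List B) xs p → ⨁ᴸ (concatMap g xs) p ≡ ⨁ᴸ xs (λ x → ⨁ᴸ (g x) p)
⨁ᴸ-concatMap g []       p = refl
⨁ᴸ-concatMap g (x ∷ xs) p = trans (⨁ᴸ-++ (g x) _ p) (cong (⨁ᴸ (g x) p xor_) (⨁ᴸ-concatMap g xs p))

⨁ᴸ-tabulate : ∀ (g : Fin n → A) p → ⨁ᴸ (List.tabulate g) p ≡ ⨁ (p ∘ g)
⨁ᴸ-tabulate {zero}  g p = refl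
⨁ᴸ-tabulate {suc n} g p = cong (p (g zero) xor_) (⨁ᴸ-tabulate (g ∘ suc) p)

odd-pairs : ∀ (p : Fin n × Fin n → Bool) → odd (length (filterᵇ p (allPairs n))) ≡ ⨁ (λ i → ⨁ (λ j → p (i , j)))
odd-pairs {n} p = begin
  odd (length (filterᵇ p (allPairs n)))                  ≡⟨ odd-filterᵇ p (allPairs n) ⟩
  ⨁ᴸ (allPairs n) p                                      ≡⟨ ⨁ᴸ-concatMap _ (allFin n) p ⟩
  ⨁ᴸ (allFin n) (λ i → ⨁ᴸ (map (i ,_) (allFin n)) p)     ≡⟨ ⨁ᴸ-tabulate {n} id (λ i → ⨁ᴸ (map (i ,_) (allFin n)) p) ⟩
  ⨁ (λ i → ⨁ᴸ (map (i ,_) (allFin n)) p)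
    ≡⟨ ⨁-cong (λ i → trans (⨁ᴸ-map (i ,_) (allFin n) p) (⨁ᴸ-tabulate id (λ j → p (i , j)))) ⟩
  ⨁ (λ i → ⨁ (λ j → p (i , j)))                          ∎
  where open ≡-Reasoning

even⇒odd≡false : ∀ {k} → Even k → odd k ≡ false
even⇒odd≡false (divides q refl) = double q
  where
  double : ∀ q → odd (q * 2) ≡ false
  double zero    = refl
  double (suc q) = trans (Boolₚ.not-involutive _) (double q)

odd≡false⇒even : ∀ k → odd k ≡ false → Even k
odd≡false⇒even 0 _ = divides 0 refl
odd≡false⇒even (suc (suc k)) e with divides q refl ← odd≡false⇒even k (trans (sym (Boolₚ.not-involutive (odd k))) e) = divides (suc q) refl

odd-edgesBetween : ∀ (A : Graph n) S T → odd (edgesBetween A S T) ≡ ⨁ (λ x → lookup S x ∧ deg (adjᵇ A) (lookup T) x)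
odd-edgesBetween {n} A S T = trans (odd-pairs {n} _)
  (⨁-cong (λ x → ⨁-∧ {n} (lookup S x) (λ y → lookup T y ∧ adjᵇ A x y)))

upper-pairs : ∀ (t : Tri n) → ⨁ (λ i → ⨁ (λ j → (toℕ i <ᵇ toℕ j) ∧ adj t i j)) ≡ edgeParity t everything
upper-pairs {zero}  t       = refl
upper-pairs {suc n} (r , t) = cong (⨁ (λ j → lookup r j) xor_) (upper-pairs t)

odd-edgeCount : ∀ (t : Tri n) → odd (edgeCount (toGraph t)) ≡ edgeParity t everything
odd-edgeCount {n} t = trans (odd-pairs {n} _) (trans
  (⨁-cong (λ i → ⨁-cong (λ j → cong ((toℕ i <ᵇ toℕ j) ∧_) (adjᵇ-toGraph t i j)))) (upper-pairs t))

lookup-─ : ∀ (p q : Sub.Subset n) x → lookup (p Sub.─ q) x ≡ lookup p x ∧ not (lookup q x)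
lookup-─ (true  ∷ p) (true  ∷ q) zero    = refl
lookup-─ (false ∷ p) (true  ∷ q) zero    = refl
lookup-─ (true  ∷ p) (false ∷ q) zero    = refl
lookup-─ (false ∷ p) (false ∷ q) zero    = refl
lookup-─ (b ∷ p) (c ∷ q) (suc x) = lookup-─ p q x

module _ {t : Tri n} where

  private
    G = toGraph t

  removal-step : ∀ {V T : VSet n} → T ⊑ V → (∀ x y → T x ≡ true → T y ≡ true → adj t x y ≡ false) →
    (∃[ x ] T x ≡ true) → ⨁ (λ x → T x ∧ deg (adj t) V x) ≡ false →
    EvenDecFrom G (tabulate (V ⊻ T)) → EvenDecFrom G (tabulate V)
  removal-step {V} {T} T⊑V ind (c , Tc) ev = step (tabulate (V ⊻ T))
    ((λ {x} x∈ → member (⊻-⊑ T T⊑V x (member⁻¹ x∈))) , c , member (T⊑V c Tc) ,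
      λ c∈ → true≢false (member⁻¹ c∈) (cong₂ _xor_ (T⊑V c Tc) Tc))
    (λ x y x∈ y∈ → trans (adjᵇ-toGraph t x y) (ind x y (in-T x∈) (in-T y∈)))
    (odd≡false⇒even _ (trans (odd-edgesBetween G (tabulate V Sub.─ tabulate (V ⊻ T)) (tabulate (V ⊻ T)))
      (trans (⨁-cong same) ev)))
    where
    member : ∀ {U : VSet n} {x} → U x ≡ true → x Sub.∈ tabulate U
    member {U} {x} Ux = Vecₚ.lookup⇒[]= x _ (trans (Vecₚ.lookup∘tabulate U x) Ux)
    member⁻¹ : ∀ {U : VSet n} {x} → x Sub.∈ tabulate U → U x ≡ true
    member⁻¹ {U} {x} x∈ = trans (sym (Vecₚ.lookup∘tabulate U x)) (Vecₚ.[]=⇒lookup x∈)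
    difference : ∀ x → lookup (tabulate V Sub.─ tabulate (V ⊻ T)) x ≡ T x
    difference x rewrite lookup-─ (tabulate V) (tabulate (V ⊻ T)) x
                       | Vecₚ.lookup∘tabulate V x | Vecₚ.lookup∘tabulate (V ⊻ T) x
      with V x in Vx | T x in Tx
    ... | true  | true  = refl
    ... | true  | false = refl
    ... | false | false = refl
    ... | false | true  = true≢false (T⊑V x Tx) Vx
    in-T : ∀ {x} → x Sub.∈ (tabulate V Sub.─ tabulate (V ⊻ T)) → T x ≡ true
    in-T {x} x∈ = trans (sym (difference x)) (Vecₚ.[]=⇒lookup x∈)
    same : ∀ x → lookup (tabulate V Sub.─ tabulate (V ⊻ T)) x ∧ deg (adjᵇ G) (lookup (tabulate (V ⊻ T))) x
               ≡ T x ∧ deg (adj t) V x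
    same x = trans (cong (_∧ deg (adjᵇ G) (lookup (tabulate (V ⊻ T))) x) (difference x)) (∧-congʳ-true λ Tx → begin
      deg (adjᵇ G) (lookup (tabulate (V ⊻ T))) x
        ≡⟨ ⨁-cong (λ y → cong₂ _∧_ (Vecₚ.lookup∘tabulate (V ⊻ T) y) (adjᵇ-toGraph t x y)) ⟩
      deg (adj t) (V ⊻ T) x
        ≡⟨ deg-⊻ (adj t) V T x ⟩
      deg (adj t) V x xor deg (adj t) T x
        ≡⟨ cong (deg (adj t) V x xor_) (⨁-≡false λ y → trans (∧-congʳ-true (ind x y Tx)) (Boolₚ.∧-zeroʳ (T y))) ⟩
      deg (adj t) V x xor false
        ≡⟨ Boolₚ.xor-identityʳ _ ⟩
      deg (adj t) V x ∎)
      where open ≡-Reasoning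

  path⇒evenDec : ∀ {F V W} → Path (adj t) F V W → EvenDecFrom G (tabulate W) → EvenDecFrom G (tabulate V)
  path⇒evenDec (stop e) d = subst (EvenDecFrom G) (sym (Vecₚ.tabulate-cong e)) d
  path⇒evenDec (step T T⊑ T∌F ind ne ev p) d = removal-step T⊑ ind ne ev (path⇒evenDec p d)

  tabulate-const : ∀ {m} (b : Bool) → tabulate {n = m} (λ _ → b) ≡ Vec.replicate m b
  tabulate-const {zero}  b = refl
  tabulate-const {suc m} b = cong (b ∷_) (tabulate-const b)

  nothing-left : ∀ {V : VSet n} → (∀ x → V x ≡ false) → EvenDecFrom G (tabulate V)
  nothing-left e = subst (EvenDecFrom G) (sym (trans (Vecₚ.tabulate-cong e) (tabulate-const false))) done

  independent⇒evenDec : ∀ {V : VSet n} → (∀ x y → V x ≡ true → V y ≡ true → adj t x y ≡ false) → EvenDecFrom G (tabulate V)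
  independent⇒evenDec {V} ind with Finₚ.any? (λ x → V x Boolₚ.≟ true)
  ... | no empty = nothing-left λ x → ≢true⇒false λ Vx → empty (x , Vx)
  ... | yes ne = removal-step (λ _ Vx → Vx) ind ne
    (⨁-≡false λ x → trans (∧-congʳ-true λ Vx → ⨁-≡false λ y → trans (∧-congʳ-true (ind x y Vx)) (Boolₚ.∧-zeroʳ (V y))) (Boolₚ.∧-zeroʳ (V x)))
    (nothing-left λ x → Boolₚ.xor-same (V x))

  edgeParity-delete : ∀ V c → edgeParity t (V ⊻ δ c) ≡ edgeParity t V xor deg (adj t) V c
  edgeParity-delete V c = trans (edgeParity-⊻ t V (δ c)) (cong₂ _xor_
    (trans (cong (edgeParity t V xor_) (edgeParity-independent t (δ c) λ x y x≡ y≡ → subst₂ (λ z w → adj t z w ≡ false) (δ-true {c = c} {x} x≡) (δ-true {c = c} {y} y≡) (adj-irrefl t c)))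
           (Boolₚ.xor-identityʳ (edgeParity t V)))
    (⨁-δ c (deg (adj t) V)))

  -- A remaining clique of one or two odd vertices would make the number of edges odd.
  small-clique⇒evenDec : ∀ {F O W} → edgeParity t everything ≡ false →
    (∀ x y → O x ≡ false → O y ≡ false → adj t x y ≡ false) →
    Path (adj t) F everything W → OddClique (adj t) O W → ∣ O ∩ W ∣ ≤ 2 → HasEvenDecomposition G
  small-clique⇒evenDec {F} {O} {W} even ind path (oddClique cl od) size =
    subst (EvenDecFrom G) (tabulate-const true) (path⇒evenDec path (independent⇒evenDec
      λ x y Wx Wy → ind x y (∉O x Wx) (∉O y Wy)))
    where
    outside⇒even : ∀ {V} → ¬ (∃[ x ] O x ∧ V x ≡ true) → edgeParity t V ≡ false
    outside⇒even {V} none = edgeParity-independent t V λ x y Vx Vy → ind x y (out x Vx) (out y Vy)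
      where
      out : ∀ x → V x ≡ true → O x ≡ false
      out x Vx = ≢true⇒false λ Ox → none (x , cong₂ _∧_ Ox Vx)
    even-W : edgeParity t W ≡ false
    even-W = trans (sym (path-edgeParity path)) even
    smaller : ∀ {V} c → O c ∧ V c ≡ true → ∣ O ∩ V ⊻ δ c ∣ < ∣ O ∩ V ∣
    smaller {V} c OVc = ≤-reflexive (sym (#-remove c OVc
      (trans (cong (O c ∧_) (delete-self {V = V} c (proj₂ (∧-true OVc)))) (Boolₚ.∧-zeroʳ (O c)))
      (λ x c≢x → sym (∧-delete {O = O} {V} c≢x))))
    no-clique : ¬ (∃[ x ] O x ∧ W x ≡ true)
    no-clique (c , OWc) with Finₚ.any? (λ x → (O x ∧ (W ⊻ δ c) x) Boolₚ.≟ true)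
    ... | no none = true≢false odd₁ (outside⇒even none)
      where
      odd₁ : edgeParity t (W ⊻ δ c) ≡ true
      odd₁ = trans (edgeParity-delete W c) (cong₂ _xor_ even-W (od c (proj₁ (∧-true OWc)) (proj₂ (∧-true OWc))))
    ... | yes (d , OW₁d) = true≢false odd₂ (outside⇒even (λ (x , e) → n≮0 (≤-trans (s≤s z≤n) (≤-trans
            (#-strict {f = λ _ → false} x (λ _ ()) refl e)
            (s≤s⁻¹ (≤-trans (smaller {W ⊻ δ c} d OW₁d) (s≤s⁻¹ (≤-trans (smaller {W} c OWc) size))))))))
      where
      Oc = proj₁ (∧-true OWc)
      Wc = proj₂ (∧-true OWc)
      Od = proj₁ (∧-true {O d} OW₁d)
      W₁d = proj₂ (∧-true {O d} OW₁d)
      d≢c : d ≢ c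
      d≢c refl = true≢false W₁d (delete-self {V = W} c Wc)
      Wd : W d ≡ true
      Wd = trans (sym (delete-other {V = W} (d≢c ∘ sym))) W₁d
      -- Deleting `c` removes an odd number of edges. The vertex `d` was odd and loses its neighbour
      -- `c`, so it then removes an even number.
      odd₂ : edgeParity t ((W ⊻ δ c) ⊻ δ d) ≡ true
      odd₂ = trans (edgeParity-delete (W ⊻ δ c) d) (cong₂ _xor_
        (trans (edgeParity-delete W c) (cong₂ _xor_ even-W (od c Oc Wc)))
        (trans (deg-delete (adj t) W c d) (cong₂ _xor_ (od d Od Wd) (cl d c Od Oc Wd Wc d≢c))))
    ∉O : ∀ x → W x ≡ true → O x ≡ false
    ∉O x Wx = ≢true⇒false λ Ox → no-clique (x , cong₂ _∧_ Ox Wx)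

-- Independent blocks

image : (Fin m → Fin n) → VSet n
image {zero}  f x = false
image {suc m} f x = δ (f zero) x ∨ image (f ∘ suc) x

image-∈ : ∀ (f : Fin m → Fin n) i → image f (f i) ≡ true
image-∈ f zero    = cong (_∨ image (f ∘ suc) (f zero)) (δ-refl (f zero))
image-∈ f (suc i) = trans (cong (δ (f zero) (f (suc i)) ∨_) (image-∈ (f ∘ suc) i)) (Boolₚ.∨-zeroʳ _)

image-∉ : ∀ (f : Fin m → Fin n) {x} → (∀ i → f i ≢ x) → image f x ≡ false
image-∉ {zero}  f f≢x = refl
image-∉ {suc m} f f≢x = cong₂ _∨_ (δ-≢ (f≢x zero)) (image-∉ (f ∘ suc) (f≢x ∘ suc))

image⁻¹ : ∀ (f : Fin m → Fin n) {x} → image f x ≡ true → ∃[ i ] f i ≡ x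
image⁻¹ {suc m} f {x} e with f zero Finₚ.≟ x
... | yes p = zero , p
... | no  _ with i , p ← image⁻¹ (f ∘ suc) e = suc i , p

#-false : ∀ n → # {n} (λ _ → false) ≡ 0
#-false zero    = refl
#-false (suc n) = #-false n

#-δ : ∀ (c : Fin n) → # (δ c) ≡ 1
#-δ {n} c = trans (#-remove {g = λ _ → false} c (δ-refl c) refl (λ x c≢x → δ-≢ c≢x)) (cong suc (#-false n))

#-image : ∀ (f : Fin m → Fin n) → # (image f) ≤ m
#-image {zero}  {n} f = ≤-reflexive (#-false n)
#-image {suc m} f = ≤-trans (#-∪ {g = δ (f zero)} {h = image (f ∘ suc)} cover)
  (+-mono-≤ (≤-reflexive (#-δ (f zero))) (#-image (f ∘ suc)))
  where
  cover : ∀ x → δ (f zero) x ∨ image (f ∘ suc) x ≡ true → δ (f zero) x ≡ false → image (f ∘ suc) x ≡ true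
  cover x e d rewrite d = e

pull : (Fin m → Fin n) → Tri m → Adj n
pull f y u v with Finₚ.any? (λ i → f i Finₚ.≟ u) | Finₚ.any? (λ j → f j Finₚ.≟ v)
... | yes (i , _) | yes (j , _) = adj y i j
... | yes _       | no _        = false
... | no _        | _           = false

pull-sym : ∀ (f : Fin m → Fin n) y u v → pull f y u v ≡ pull f y v u
pull-sym f y u v with Finₚ.any? (λ i → f i Finₚ.≟ u) | Finₚ.any? (λ j → f j Finₚ.≟ v)
... | yes (i , _) | yes (j , _) = adj-sym y i j
... | yes _       | no _        = refl
... | no _        | yes _       = refl
... | no _        | no _        = refl

pull-irrefl : ∀ (f : Fin m → Fin n) y u → pull f y u u ≡ false
pull-irrefl f y u with Finₚ.any? (λ i → f i Finₚ.≟ u)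
... | yes (i , _) = adj-irrefl y i
... | no _        = refl

pull-∉ : ∀ (f : Fin m → Fin n) y {u v} → (∀ i → f i ≢ u) → pull f y u v ≡ false
pull-∉ f y {u} {v} f≢u with Finₚ.any? (λ i → f i Finₚ.≟ u) | Finₚ.any? (λ j → f j Finₚ.≟ v)
... | yes (i , e) | _ = ⊥-elim (f≢u i e)
... | no _        | _ = refl

pull-∈ : ∀ (f : Fin m → Fin n) → (∀ {i j} → f i ≡ f j → i ≡ j) → ∀ y i j → pull f y (f i) (f j) ≡ adj y i j
pull-∈ f inj y i j with Finₚ.any? (λ k → f k Finₚ.≟ f i) | Finₚ.any? (λ k → f k Finₚ.≟ f j)
... | yes (k , e) | yes (l , e′) = cong₂ (adj y) (inj e) (inj e′)
... | no none     | _            = ⊥-elim (none (i , refl))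
... | yes _       | no none      = ⊥-elim (none (j , refl))

blockToggle : (Fin m → Fin n) → Tri m → Tri n
blockToggle f y = triangle (pull f y)

adj-blockToggle : ∀ (f : Fin m → Fin n) y t u v → adj (t ⊕ blockToggle f y) u v ≡ adj t u v xor pull f y u v
adj-blockToggle f y t u v = trans (adj-⊕ t _ u v)
  (cong (adj t u v xor_) (adj-triangle (pull f y) (pull-sym f y) (pull-irrefl f y) u v))

independent? : (f : Fin m → Fin n) (t : Tri n) → Dec (∀ i j → adj t (f i) (f j) ≡ false)
independent? f t = Finₚ.all? (λ i → Finₚ.all? (λ j → adj t (f i) (f j) Boolₚ.≟ false))

independentᵇ : (Fin m → Fin n) → Tri n → Bool
independentᵇ f t = does (independent? f t)

does-true : ∀ {P : Set} (d : Dec P) → does d ≡ true → P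
does-true (yes p) _ = p

independentᵇ-cong : ∀ (f : Fin m → Fin n) {t t′} → (∀ i j → adj t (f i) (f j) ≡ adj t′ (f i) (f j)) →
                    independentᵇ f t ≡ independentᵇ f t′
independentᵇ-cong f {t} {t′} e = does-⇔
  (mk⇔ (λ ind i j → trans (sym (e i j)) (ind i j)) (λ ind i j → trans (e i j) (ind i j)))
  (independent? f t) (independent? f t′)

rescale : ∀ r e m {X P} → m * 2 ^ e ≤ 2 ^ r → 2 ^ r * X ≤ m * P → 2 ^ e * X ≤ P
rescale r e m {X} {P} small bound = *-cancelˡ-≤ (2 ^ r) {{m^n≢0 2 r}} (begin
  2 ^ r * (2 ^ e * X)   ≡⟨ *-swapˡ (2 ^ r) (2 ^ e) X ⟩
  2 ^ e * (2 ^ r * X)   ≤⟨ *-monoʳ-≤ (2 ^ e) bound ⟩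
  2 ^ e * (m * P)       ≡⟨ regroup (2 ^ e) m P ⟩
  m * 2 ^ e * P         ≤⟨ *-monoˡ-≤ P small ⟩
  2 ^ r * P             ∎)
  where
  open ≤-Reasoning
  regroup : ∀ a b c → a * (b * c) ≡ b * a * c
  regroup = solve-∀

-- Bernoulli's inequality (1 + 1/x)^m ≥ 1 + m/x, multiplied by x^(m+1).
bernoulli : ∀ x m → x ^ m * (x + m) ≤ x * suc x ^ m
bernoulli x zero    = ≤-reflexive (base x)
  where
  base : ∀ x → 1 * (x + 0) ≡ x * 1
  base = solve-∀
bernoulli x (suc m) = begin
  x * x ^ m * (x + suc m)            ≤⟨ m≤m+n _ (x ^ m * m) ⟩
  x * x ^ m * (x + suc m) + x ^ m * m ≡⟨ factor x (x ^ m) m ⟩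
  suc x * (x ^ m * (x + m))          ≤⟨ *-monoʳ-≤ (suc x) (bernoulli x m) ⟩
  suc x * (x * suc x ^ m)            ≡⟨ *-swapˡ (suc x) x (suc x ^ m) ⟩
  x * (suc x * suc x ^ m)            ∎
  where
  open ≤-Reasoning
  factor : ∀ x p m → x * p * (x + suc m) + p * m ≡ suc x * (p * (x + m))
  factor = solve-∀

-- Bernoulli with exponent x + 1 gives (1 + 1/x)^(x+1) ≥ 2 + 1/x. Thus x + 1 independent trials of
-- success probability 1/(x + 1) all fail with probability at most one half.
halving : ∀ x → 2 * x ^ suc x ≤ suc x ^ suc x
halving zero      = z≤n
halving x@(suc _) = *-cancelˡ-≤ x (begin
  x * (2 * x ^ suc x)        ≤⟨ m≤m+n _ (x ^ suc x) ⟩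
  x * (2 * x ^ suc x) + x ^ suc x ≡⟨ collect x (x ^ suc x) ⟩
  x ^ suc x * (x + suc x)    ≤⟨ bernoulli x (suc x) ⟩
  x * suc x ^ suc x          ∎)
  where
  open ≤-Reasoning
  collect : ∀ x p → x * (2 * p) + p ≡ p * (x + suc x)
  collect = solve-∀

halving-power : ∀ x e → 2 ^ e * x ^ (suc x * e) ≤ suc x ^ (suc x * e)
halving-power x e = begin
  2 ^ e * x ^ (suc x * e)     ≡⟨ cong (2 ^ e *_) (sym (^-*-assoc x (suc x) e)) ⟩
  2 ^ e * (x ^ suc x) ^ e     ≡⟨ sym (^-distribʳ-* e 2 (x ^ suc x)) ⟩
  (2 * x ^ suc x) ^ e         ≤⟨ ^-monoˡ-≤ e (halving x) ⟩
  (suc x ^ suc x) ^ e         ≡⟨ ^-*-assoc (suc x) (suc x) e ⟩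
  suc x ^ (suc x * e)         ∎
  where open ≤-Reasoning

-- Four used vertices buy one halving, since (5/6)⁴ ≤ 1/2, and one more vertex serves as the partner
-- `z`: hence the sizes `suc (4 * r₂)` and `suc (4 * r₁)`.
module Blocks {n b : ℕ} (r₁ r₂ : ℕ)
  (block : Fin b → Fin (suc (4 * r₂)) → Fin n) (reservoir : Fin (suc (4 * r₁)) → Fin n)
  (block-injective : ∀ {i j x y} → block i x ≡ block j y → i ≡ j × x ≡ y)
  (reservoir-injective : ∀ {x y} → reservoir x ≡ reservoir y → x ≡ y)
  (reservoir-fresh : ∀ i x y → reservoir x ≢ block i y)
  (bad : Tri n → Bool) (bad⇒Bad : ∀ t → bad t ≡ true → Bad (toGraph t))
  where

  -- `w` is determined by the edges inside the blocks other than `j`. It is thus independent of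
  -- block `j` and also blind to every toggle that spares the edges inside blocks.
  Unaffected : Fin b → (Tri n → Bool) → Set
  Unaffected j w = ∀ t t′ → (∀ i → i ≢ j → ∀ x y → adj t (block i x) (block i y) ≡ adj t′ (block i x) (block i y)) → w t ≡ w t′

  -- Adding all graphs `y` on block `j` sorts the graphs into orbits on which `w` is constant. Among
  -- the `suc T` choices of `y` at least one makes the block independent.
  some-not-independent : ∀ j (w : Tri n → Bool) {T} → length (tris (suc (4 * r₂))) ≡ suc T → Unaffected j w →
    suc T * ∑ (tris n) (λ t → bit (w t ∧ not (independentᵇ (block j) t))) ≤ T * ∑ (tris n) (bit ∘ w)
  some-not-independent j w {T} size stable = begin
    suc T * ∑ (tris n) f
      ≡⟨ cong (_* ∑ (tris n) f) (sym size) ⟩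
    length (tris k) * ∑ (tris n) f
      ≡⟨ sym (∑-const (tris k) _) ⟩
    ∑ (tris k) (λ y → ∑ (tris n) f)
      ≡⟨ ∑-cong (tris k) (λ y → sym (∑-tris-⊕ (blockToggle (block j) y) f)) ⟩
    ∑ (tris k) (λ y → ∑ (tris n) (λ t → f (t ⊕ blockToggle (block j) y)))
      ≡⟨ ∑-comm (tris k) (tris n) _ ⟩
    ∑ (tris n) (λ t → ∑ (tris k) (λ y → f (t ⊕ blockToggle (block j) y)))
      ≤⟨ ∑-mono (tris n) orbit ⟩
    ∑ (tris n) (λ t → T * bit (w t))
      ≡⟨ sym (*-distribˡ-∑ T (tris n) _) ⟩
    T * ∑ (tris n) (bit ∘ w) ∎
    where
    open ≤-Reasoning
    k = suc (4 * r₂)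
    f : Tri n → ℕ
    f t = bit (w t ∧ not (independentᵇ (block j) t))
    w-stable : ∀ t y → w (t ⊕ blockToggle (block j) y) ≡ w t
    w-stable t y = stable _ _ λ i i≢j u v → trans (adj-blockToggle (block j) y t (block i u) (block i v))
      (trans (cong (adj t (block i u) (block i v) xor_) (pull-∉ (block j) y {block i u} {block i v} (λ x e → i≢j (sym (proj₁ (block-injective e))))))
             (Boolₚ.xor-identityʳ _))
    orbit : ∀ t → ∑ (tris k) (λ y → f (t ⊕ blockToggle (block j) y)) ≤ T * bit (w t)
    orbit t = begin
      ∑ (tris k) (λ y → f (t ⊕ blockToggle (block j) y))
        ≡⟨ ∑-cong (tris k) (λ y → trans (bit-∧ (w (t ⊕ blockToggle (block j) y)) _) (cong (λ c → bit c * bit (dependent y)) (w-stable t y))) ⟩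
      ∑ (tris k) (λ y → bit (w t) * bit (dependent y))
        ≡⟨ sym (*-distribˡ-∑ (bit (w t)) (tris k) _) ⟩
      bit (w t) * ∑ (tris k) (bit ∘ dependent)
        ≤⟨ *-monoʳ-≤ (bit (w t)) (s≤s⁻¹ (≤-trans (∑-bit<length dependent (∈-tris y₀) vanishes) (≤-reflexive size))) ⟩
      bit (w t) * T
        ≡⟨ *-comm (bit (w t)) T ⟩
      T * bit (w t) ∎
      where
      dependent : Tri k → Bool
      dependent y = not (independentᵇ (block j) (t ⊕ blockToggle (block j) y))
      -- Toggling exactly the edges present in the block empties it.
      y₀ : Tri k
      y₀ = triangle (λ u v → adj t (block j u) (block j v))
      vanishes : dependent y₀ ≡ false
      vanishes = cong not (dec-true (independent? (block j) (t ⊕ blockToggle (block j) y₀)) λ u v →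
        trans (adj-blockToggle (block j) y₀ t (block j u) (block j v)) (trans (cong (adj t (block j u) (block j v) xor_)
          (trans (pull-∈ (block j) (proj₂ ∘ block-injective) y₀ u v)
                 (adj-triangle (λ u v → adj t (block j u) (block j v)) (λ u v → adj-sym t (block j u) (block j v)) (λ u → adj-irrefl t (block j u)) u v)))
          (Boolₚ.xor-same (adj t (block j u) (block j v)))))

  none : List (Fin b) → (Tri n → Bool) → Tri n → Bool
  none []       w = w
  none (j ∷ js) w = none js (λ t → w t ∧ not (independentᵇ (block j) t))

  stable-none : ∀ {i j} w → i ≢ j → Unaffected i w → Unaffected i (λ t → w t ∧ not (independentᵇ (block j) t))
  stable-none {i} {j} w i≢j stable t t′ e =
    cong₂ (λ c d → c ∧ not d) (stable t t′ e) (independentᵇ-cong (block j) {t} {t′} (e j (i≢j ∘ sym)))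

  few-none : ∀ js w {T} → length (tris (suc (4 * r₂))) ≡ suc T → Unique js → All (λ j → Unaffected j w) js →
    suc T ^ length js * ∑ (tris n) (bit ∘ none js w) ≤ T ^ length js * ∑ (tris n) (bit ∘ w)
  few-none []       w     size uniq stable = ≤-refl
  few-none (j ∷ js) w {T} size (j∉js ∷ uniq) (stable ∷ stables) = begin
    suc T * suc T ^ k * N                    ≡⟨ *-assoc (suc T) (suc T ^ k) N ⟩
    suc T * (suc T ^ k * N)                  ≤⟨ *-monoʳ-≤ (suc T) (few-none js w′ size uniq
                                                  (All.zipWith (λ { (j≢i , st) → stable-none w (j≢i ∘ sym) st }) (j∉js , stables))) ⟩
    suc T * (T ^ k * ∑ (tris n) (bit ∘ w′))  ≡⟨ *-swapˡ (suc T) (T ^ k) _ ⟩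
    T ^ k * (suc T * ∑ (tris n) (bit ∘ w′))  ≤⟨ *-monoʳ-≤ (T ^ k) (some-not-independent j w size stable) ⟩
    T ^ k * (T * ∑ (tris n) (bit ∘ w))       ≡⟨ regroup (T ^ k) T _ ⟩
    T * T ^ k * ∑ (tris n) (bit ∘ w)         ∎
    where
    open ≤-Reasoning
    k = length js
    w′ : Tri n → Bool
    w′ t = w t ∧ not (independentᵇ (block j) t)
    N = ∑ (tris n) (bit ∘ none js w′)
    regroup : ∀ a b c → a * (b * c) ≡ b * a * c
    regroup = solve-∀

  residual : ℕ
  residual = suc (4 * r₁) + 2

  -- The outcome of the first round, expressed as the mere existence of a path that avoids block
  -- `j`. In this form it depends on the graph only up to `Agree`, so the second round can condition
  -- on it.
  Reaches : Fin b → Tri n → Set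
  Reaches j t = ∃[ W ] Path (adj t) S everything W × OddClique (adj t) (not ∘ S) W × ∣ not ∘ S ∩ W ∣ ≤ residual
    where S = image (block j)

  module _ (j : Fin b) (reaches? : ∀ t → Dec (Reaches j t)) (w : Tri n → Bool) (stable : Unaffected j w) (e : ℕ)
    (small₁ : n * 2 ^ e ≤ 2 ^ r₁) (small₂ : residual * 2 ^ e ≤ 2 ^ r₂) where

    private
      S R : VSet n
      S = image (block j)
      R = image reservoir

      w₁ w₂ : Tri n → Bool
      w₁ t = w t ∧ independentᵇ (block j) t
      w₂ t = w₁ t ∧ does (reaches? t)

      w₁-cong : ∀ {t t′} → (∀ i x y → adj t (block i x) (block i y) ≡ adj t′ (block i x) (block i y)) → w₁ t ≡ w₁ t′
      w₁-cong {t} {t′} e = cong₂ _∧_ (stable t t′ (λ i _ → e i)) (independentᵇ-cong (block j) {t} {t′} (e j))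

      not-not : ∀ {c} → not c ≡ true → c ≡ false
      not-not = Boolₚ.not-injective

    rarely-unreached : 2 ^ e * ∑ (tris n) (λ t → bit (w₁ t ∧ not (does (reaches? t)))) ≤ ∑ (tris n) (bit ∘ w₁)
    rarely-unreached = rescale r₁ e n small₁ (bad-fraction r₁ Q Kept n w₁
      (length-tabulate (reservoir ∘ suc)) (λ x → not-not) (Kept-reservoir zero)
      (Allₚ.tabulate⁺ λ i → Kept-reservoir (suc i) , S-reservoir (suc i))
      (Allₚ.tabulate⁺ λ i e → Finₚ.0≢1+n (reservoir-injective e))
      (Uniqueₚ.tabulate⁺ (λ e → Finₚ.suc-injective (reservoir-injective e)))
      (λ x Sx → cong (_∨ R x) Sx)
      -- Every toggled edge has an end in the reservoir and so lies in no block, and `w₁` reads only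
      -- edges inside blocks.
      (Allₚ.tabulate⁺ λ i y t → w₁-cong λ k u v → flip-≢ Rest (reservoir (suc i)) z y t _ _
         (reservoir-fresh k _ u) (reservoir-fresh k _ u) (reservoir-fresh k _ v) (reservoir-fresh k _ v))
      (λ t _ → let W , p , oc = greedy {a = adj t} {Kept} {everything} n (adj-sym t) (adj-irrefl t) (#≤n _)
               in W , p , oc , #≤n _))
      where
      Kept Rest : VSet n
      Kept x = S x ∨ R x
      Rest x = not (Kept x)
      z = reservoir zero
      Q = List.tabulate (reservoir ∘ suc)
      Kept-reservoir : ∀ i → Kept (reservoir i) ≡ true
      Kept-reservoir i = trans (cong (S (reservoir i) ∨_) (image-∈ reservoir i)) (Boolₚ.∨-zeroʳ _)
      S-reservoir : ∀ i → S (reservoir i) ≡ false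
      S-reservoir i = image-∉ (block j) (λ x e → reservoir-fresh j i x (sym e))
      unreached : Tri n → Bool
      unreached t = not (does (reaches? t))
      reached : ∀ t W → Path (adj t) S everything W → OddClique (adj t) Rest W → ∣ Rest ∩ W ∣ ≤ 2 → unreached t ≡ false
      reached t W p oc size = cong not (dec-true (reaches? t) (
          -- The reservoir is released here: what now survives outside `S` lies in `R` or was among
          -- the at most two survivors in `Rest`.
          let W′ , p′ , oc′ = greedy {a = adj t} {S} {W} n (adj-sym t) (adj-irrefl t) (#≤n _) in
          W′ , path-trans p p′ , oc′ ,
          ≤-trans (#-∪ {g = R} {h = λ x → Rest x ∧ W x} (λ x SW Rx →
                     cong₂ _∧_ (cong not (cong₂ _∨_ (not-not {S x} (proj₁ (∧-true SW))) Rx)) (path-⊑ p′ x (proj₂ (∧-true {not (S x)} SW)))))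
                  (+-mono-≤ (#-image reservoir) size)))
      open Elimination Rest z S unreached reached

    -- Independence of the block occurs in the event as well as in the weight `w₂`: the hypothesis
    -- of `Elimination` sees the event alone and needs it to finish the decomposition.
    rarely-bad : 2 ^ e * ∑ (tris n) (λ t → bit (w₂ t ∧ (bad t ∧ independentᵇ (block j) t))) ≤ ∑ (tris n) (bit ∘ w₂)
    rarely-bad = rescale r₂ e residual small₂ (bad-fraction r₂ Q S residual w₂
      (length-tabulate (block j ∘ suc)) (λ x → not-not) (image-∈ (block j) zero)
      (Allₚ.tabulate⁺ λ i → image-∈ (block j) (suc i) , refl)
      (Allₚ.tabulate⁺ λ i e → Finₚ.0≢1+n (proj₂ (block-injective e)))
      (Uniqueₚ.tabulate⁺ (λ e → Finₚ.suc-injective (proj₂ (block-injective e))))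
      (λ x ())
      -- Toggled edges run between block `j` and its complement, so none lies inside a block;
      -- `Reaches` carries over in both directions.
      (Allₚ.tabulate⁺ λ i y t → cong₂ _∧_ (w₁-cong (same-blocks i y t))
         (does-⇔ (mk⇔ (transport (agree-sym (agree i y t))) (transport (agree i y t))) (reaches? _) (reaches? t)))
      (λ t w₂t → does-true (reaches? t) (proj₂ (∧-true {w₁ t} w₂t))))
      where
      Rest : VSet n
      Rest = not ∘ S
      z = block j zero
      Q = List.tabulate (block j ∘ suc)
      agree : ∀ i y t → Agree S (adj t) (adj (flip Rest (block j (suc i)) z y t))
      agree i y t = flip-agree Rest (block j (suc i)) z y t (λ x → not-not) (image-∈ (block j) (suc i)) (image-∈ (block j) zero)
      transport : ∀ {t t′} → Agree S (adj t) (adj t′) → Reaches j t → Reaches j t′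
      transport {t} ag (W , p , oc , size) = W , path-agree ag (λ _ _ → refl) p ,
        agree-oddClique {a = adj t} ag (λ x → not-not) (path-keeps p (λ _ _ → refl)) oc , size
      same-blocks : ∀ i y t k u v → adj (flip Rest (block j (suc i)) z y t) (block k u) (block k v) ≡ adj t (block k u) (block k v)
      same-blocks i y t k u v with k Finₚ.≟ j
      ... | yes refl = flip-∉O Rest (block j (suc i)) z y t _ _ (cong not (image-∈ (block j) u)) (cong not (image-∈ (block j) v))
      ... | no k≢j = flip-≢ Rest (block j (suc i)) z y t _ _ (apart _ u) (apart _ u) (apart _ v) (apart _ v)
        where
        apart : ∀ x y → block j x ≢ block k y
        apart x y e = k≢j (sym (proj₁ (block-injective e)))
      bad-independent : Tri n → Bool
      bad-independent t = bad t ∧ independentᵇ (block j) t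
      nothing : VSet n
      nothing x = false
      not-bad : ∀ t W → Path (adj t) nothing everything W → OddClique (adj t) Rest W → ∣ Rest ∩ W ∣ ≤ 2 → bad-independent t ≡ false
      not-bad t W p oc size = ≢true⇒false λ bt → let _ , ev , undecomposable = bad⇒Bad t (proj₁ (∧-true bt)) in
          undecomposable (small-clique⇒evenDec {t = t} {O = Rest}
            (trans (sym (odd-edgeCount t)) (even⇒odd≡false ev))
            (λ x y Ox Oy → inside t (does-true (independent? (block j) t) (proj₂ (∧-true {bad t} bt))) Ox Oy)
            p oc size)
        where
        inside : ∀ t → (∀ i k → adj t (block j i) (block j k) ≡ false) → ∀ {x y} → Rest x ≡ false → Rest y ≡ false → adj t x y ≡ false
        inside t ind Ox Oy with i , refl ← image⁻¹ (block j) (Boolₚ.not-injective Ox) | k , refl ← image⁻¹ (block j) (Boolₚ.not-injective Oy) = ind i k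
      open Elimination Rest z nothing bad-independent not-bad

    -- A bad graph in which block `j` is independent must have failed in one of the two rounds,
    -- whence the factor 2.
    bad-with-independent : 2 ^ e * ∑ (tris n) (λ t → bit (w₁ t ∧ bad t)) ≤ 2 * ∑ (tris n) (bit ∘ w₁)
    bad-with-independent = begin
      2 ^ e * ∑ (tris n) (λ t → bit (w₁ t ∧ bad t))
        ≤⟨ *-monoʳ-≤ (2 ^ e) (∑-mono (tris n) λ t → split (w t) (independentᵇ (block j) t) (does (reaches? t)) (bad t)) ⟩
      2 ^ e * ∑ (tris n) (λ t → bit (w₁ t ∧ not (does (reaches? t))) + bit (w₂ t ∧ (bad t ∧ independentᵇ (block j) t)))
        ≡⟨ trans (cong (2 ^ e *_) (∑-distrib-+ (tris n) _ _)) (*-distribˡ-+ (2 ^ e) (∑ (tris n) (λ t → bit (w₁ t ∧ not (does (reaches? t))))) _) ⟩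
      2 ^ e * ∑ (tris n) (λ t → bit (w₁ t ∧ not (does (reaches? t)))) + 2 ^ e * ∑ (tris n) (λ t → bit (w₂ t ∧ (bad t ∧ independentᵇ (block j) t)))
        ≤⟨ +-mono-≤ rarely-unreached (≤-trans rarely-bad (∑-mono (tris n) λ t → bit-mono (λ e → proj₁ (∧-true e)))) ⟩
      ∑ (tris n) (bit ∘ w₁) + ∑ (tris n) (bit ∘ w₁)
        ≡⟨ cong (∑ (tris n) (bit ∘ w₁) +_) (sym (+-identityʳ _)) ⟩
      2 * ∑ (tris n) (bit ∘ w₁) ∎
      where
      open ≤-Reasoning
      split : ∀ w i r b → bit ((w ∧ i) ∧ b) ≤ bit ((w ∧ i) ∧ not r) + bit (((w ∧ i) ∧ r) ∧ (b ∧ i))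
      split false i     r     b     = z≤n
      split true  false r     b     = z≤n
      split true  true  false b     = bit≤1 b
      split true  true  true  false = z≤n
      split true  true  true  true  = ≤-refl

  -- The graphs are classified by their first independent block. These classes are disjoint, so the
  -- errors, each proportional to its class, add up to at most twice the total instead of growing
  -- with the number of blocks.
  telescope : ∀ (reaches? : ∀ j t → Dec (Reaches j t)) e → n * 2 ^ e ≤ 2 ^ r₁ → residual * 2 ^ e ≤ 2 ^ r₂ →
    ∀ js w → Unique js → All (λ j → Unaffected j w) js →
    2 ^ e * ∑ (tris n) (λ t → bit (w t ∧ bad t)) ≤ 2 * ∑ (tris n) (bit ∘ w) + 2 ^ e * ∑ (tris n) (bit ∘ none js w)
  telescope reaches? e small₁ small₂ []       w uniq stable = ≤-trans
    (*-monoʳ-≤ (2 ^ e) (∑-mono (tris n) λ t → bit-mono (λ e → proj₁ (∧-true {w t} e)))) (m≤n+m _ _)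
  telescope reaches? e small₁ small₂ (j ∷ js) w (j∉js ∷ uniq) (stable ∷ stables) = begin
    2 ^ e * ∑ (tris n) (λ t → bit (w t ∧ bad t))
      ≡⟨ trans (cong (2 ^ e *_) (trans (∑-cong (tris n) λ t → split (w t) (independentᵇ (block j) t) (bad t)) (∑-distrib-+ (tris n) _ _)))
               (*-distribˡ-+ (2 ^ e) (∑ (tris n) (λ t → bit (w₁ t ∧ bad t))) _) ⟩
    2 ^ e * ∑ (tris n) (λ t → bit (w₁ t ∧ bad t)) + 2 ^ e * ∑ (tris n) (λ t → bit (w′ t ∧ bad t))
      ≤⟨ +-mono-≤ (bad-with-independent j (reaches? j) w stable e small₁ small₂)
           (telescope reaches? e small₁ small₂ js w′ uniq
             (All.zipWith (λ { (j≢i , st) → stable-none w (j≢i ∘ sym) st }) (j∉js , stables))) ⟩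
    2 * ∑ (tris n) (bit ∘ w₁) + (2 * ∑ (tris n) (bit ∘ w′) + 2 ^ e * ∑ (tris n) (bit ∘ none js w′))
      ≡⟨ trans (sym (+-assoc (2 * ∑ (tris n) (bit ∘ w₁)) _ _)) (cong (_+ 2 ^ e * ∑ (tris n) (bit ∘ none js w′))
           (trans (sym (*-distribˡ-+ 2 (∑ (tris n) (bit ∘ w₁)) _)) (cong (2 *_) (trans (sym (∑-distrib-+ (tris n) _ _))
             (∑-cong (tris n) λ t → sym (bit-split (w t) (independentᵇ (block j) t))))))) ⟩
    2 * ∑ (tris n) (bit ∘ w) + 2 ^ e * ∑ (tris n) (bit ∘ none js w′) ∎
    where
    open ≤-Reasoning
    w₁ w′ : Tri n → Bool
    w₁ t = w t ∧ independentᵇ (block j) t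
    w′ t = w t ∧ not (independentᵇ (block j) t)
    split : ∀ w i b → bit (w ∧ b) ≡ bit ((w ∧ i) ∧ b) + bit ((w ∧ not i) ∧ b)
    split true  true  b = sym (+-identityʳ (bit b))
    split true  false b = refl
    split false i     b = refl

  -- A block has `suc T` possible graphs, so by `halving-power` all `suc T * e` blocks fail to be
  -- independent with probability at most 2^(-e). This adds one to the two from `telescope`.
  few-bad-graphs : ∀ e {T} → length (tris (suc (4 * r₂))) ≡ suc T → b ≡ suc T * e →
    n * 2 ^ e ≤ 2 ^ r₁ → residual * 2 ^ e ≤ 2 ^ r₂ →
    2 ^ e * ∑ (tris n) (bit ∘ bad) ≤ 3 * length (tris n)
  few-bad-graphs e {T} size b≡ small₁ small₂ = decidable-stable (_ ≤? _) λ ¬bound →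
    ¬¬-decidable (cartesianProduct (List.allFin b) (tris n)) (λ (j , t) → Reaches j t) λ dec → ¬bound (begin
      2 ^ e * ∑ (tris n) (bit ∘ bad)
        ≤⟨ telescope (λ j t → dec (∈-cartesianProduct⁺ (∈-allFin j) (∈-tris t))) e small₁ small₂
             (List.allFin b) everyone (Uniqueₚ.allFin⁺ b) (Allₚ.tabulate⁺ λ j _ _ _ → refl) ⟩
      2 * ∑ (tris n) (bit ∘ everyone) + 2 ^ e * N
        ≤⟨ +-mono-≤ (*-monoʳ-≤ 2 (∑-bit≤length (tris n) everyone)) none-rare ⟩
      2 * length (tris n) + length (tris n)
        ≡⟨ +-comm (2 * length (tris n)) _ ⟩
      3 * length (tris n) ∎)
    where
    open ≤-Reasoning
    everyone : Tri n → Bool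
    everyone _ = true
    N = ∑ (tris n) (bit ∘ none (List.allFin b) everyone)
    none-rare : 2 ^ e * N ≤ length (tris n)
    none-rare = *-cancelˡ-≤ (suc T ^ b) {{m^n≢0 (suc T) b}} (begin
      suc T ^ b * (2 ^ e * N)         ≡⟨ *-swapˡ (suc T ^ b) (2 ^ e) N ⟩
      2 ^ e * (suc T ^ b * N)         ≤⟨ *-monoʳ-≤ (2 ^ e) (subst (λ c → suc T ^ c * N ≤ T ^ c * ∑ (tris n) (bit ∘ everyone))
                                           (length-tabulate {n = b} id)
                                           (few-none (List.allFin b) everyone size (Uniqueₚ.allFin⁺ b) (Allₚ.tabulate⁺ λ j _ _ _ → refl))) ⟩
      2 ^ e * (T ^ b * ∑ (tris n) (bit ∘ everyone))
                                      ≤⟨ *-monoʳ-≤ (2 ^ e) (*-monoʳ-≤ (T ^ b) (∑-bit≤length (tris n) everyone)) ⟩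
      2 ^ e * (T ^ b * length (tris n))
                                      ≡⟨ sym (*-assoc (2 ^ e) (T ^ b) _) ⟩
      2 ^ e * T ^ b * length (tris n) ≤⟨ *-monoˡ-≤ (length (tris n)) (subst (λ c → 2 ^ e * T ^ c ≤ suc T ^ c) (sym b≡) (halving-power T e)) ⟩
      suc T ^ b * length (tris n)     ∎)

-- Choice of parameters

_≟ᴳ_ : (A B : Graph n) → Dec (A ≡ B)
_≟ᴳ_ = Vecₚ.≡-dec (Vecₚ.≡-dec Boolₚ._≟_)

member? : (L : List (Graph n)) (A : Graph n) → Dec (Any (A ≡_) L)
member? L A = Any.any? (A ≟ᴳ_) L

-- Double counting of the pairs of an entry `A` and a triangle representing it: simplicity gives
-- every entry a triangle, and uniqueness lets each triangle account for at most one entry.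
length≤∑-member : ∀ (L : List (Graph n)) → Unique L → All IsSimple L →
                  length L ≤ ∑ (tris n) (λ t → bit (does (member? L (toGraph t))))
length≤∑-member {n} L uniq simple = begin
  length L
    ≤⟨ occurs L simple ⟩
  ∑ L (λ A → ∑ (tris n) (λ t → bit (does (toGraph t ≟ᴳ A))))
    ≡⟨ ∑-comm L (tris n) _ ⟩
  ∑ (tris n) (λ t → ∑ L (λ A → bit (does (toGraph t ≟ᴳ A))))
    ≤⟨ ∑-mono (tris n) (λ t → once L uniq (toGraph t)) ⟩
  ∑ (tris n) (λ t → bit (does (member? L (toGraph t)))) ∎
  where
  open ≤-Reasoning
  occurs : ∀ L → All IsSimple L → length L ≤ ∑ L (λ A → ∑ (tris n) (λ t → bit (does (toGraph t ≟ᴳ A))))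
  occurs []      []       = z≤n
  occurs (A ∷ L) (s ∷ ss) = +-mono-≤
    (≤-trans (≤-reflexive (cong bit (sym (dec-true (toGraph (triangle (adjᵇ A)) ≟ᴳ A) (toGraph-triangle A s)))))
             (∈⇒≤∑ (λ t → bit (does (toGraph t ≟ᴳ A))) (∈-tris (triangle (adjᵇ A)))))
    (occurs L ss)
  absent : ∀ L B → All (B ≢_) L → ∑ L (λ A → bit (does (B ≟ᴳ A))) ≡ 0
  absent []      B []         = refl
  absent (A ∷ L) B (B≢A ∷ B∉) = cong₂ (λ b k → bit b + k) (dec-false (B ≟ᴳ A) B≢A) (absent L B B∉)
  once : ∀ L → Unique L → ∀ B → ∑ L (λ A → bit (does (B ≟ᴳ A))) ≤ bit (does (member? L B))
  once []      _            B = z≤n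
  once (A ∷ L) (A∉L ∷ uniq) B with B ≟ᴳ A
  ... | yes refl = ≤-reflexive (cong suc (absent L B A∉L))
  ... | no  _    = once L uniq B

module Layout (b k r : ℕ) {n : ℕ} (fits : b * k + r ≤ n) where

  private
    blockIndex : Fin b → Fin k → Fin (b * k + r)
    blockIndex i x = combine i x ↑ˡ r

  blockVertex : Fin b → Fin k → Fin n
  blockVertex i x = inject≤ (blockIndex i x) fits

  reservoirVertex : Fin r → Fin n
  reservoirVertex x = inject≤ ((b * k) ↑ʳ x) fits

  blockVertex-injective : ∀ {i j x y} → blockVertex i x ≡ blockVertex j y → i ≡ j × x ≡ y
  blockVertex-injective {i} {j} {x} {y} e =
    Finₚ.combine-injective i x j y (Finₚ.↑ˡ-injective r _ _ (Finₚ.inject≤-injective fits fits _ _ e))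

  reservoirVertex-injective : ∀ {x y} → reservoirVertex x ≡ reservoirVertex y → x ≡ y
  reservoirVertex-injective e = Finₚ.↑ʳ-injective (b * k) _ _ (Finₚ.inject≤-injective fits fits _ _ e)

  reservoirVertex-fresh : ∀ i x y → reservoirVertex x ≢ blockVertex i y
  reservoirVertex-fresh i x y e with
    trans (sym (Finₚ.splitAt-↑ʳ (b * k) r x)) (trans (cong (splitAt (b * k)) (Finₚ.inject≤-injective fits fits _ _ e)) (Finₚ.splitAt-↑ˡ (b * k) (combine i y) r))
  ... | ()

bad-count : ∀ {n} r₁ r₂ e → length (tris (suc (4 * r₂))) * e * suc (4 * r₂) + suc (4 * r₁) ≤ n →
  n * 2 ^ e ≤ 2 ^ r₁ → (suc (4 * r₁) + 2) * 2 ^ e ≤ 2 ^ r₂ →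
  (L : List (Graph n)) → Unique L → All Bad L → 2 ^ e * length L ≤ 3 * 2 ^ (n C 2)
bad-count {n} r₁ r₂ e fits small₁ small₂ L uniq allBad
  with length (tris (suc (4 * r₂))) in size
... | zero with () ← subst (0 <_) size (≤-trans (s≤s z≤n) (∑-bit<length (λ _ → false) (∈-tris (triangle {suc (4 * r₂)} (λ _ _ → false))) refl))
... | suc T = begin
  2 ^ e * length L
    ≤⟨ *-monoʳ-≤ (2 ^ e) (length≤∑-member L uniq (All.map proj₁ allBad)) ⟩
  2 ^ e * ∑ (tris n) (bit ∘ bad)
    ≤⟨ few-bad-graphs e size refl small₁ small₂ ⟩
  3 * length (tris n)
    ≡⟨ cong (3 *_) (length-tris n) ⟩
  3 * 2 ^ (n C 2) ∎
  where
  open ≤-Reasoning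
  bad : Tri n → Bool
  bad t = does (member? L (toGraph t))
  bad⇒Bad : ∀ t → bad t ≡ true → Bad (toGraph t)
  bad⇒Bad t e = All.lookup allBad (does-true (member? L (toGraph t)) e)
  open Layout (suc T * e) (suc (4 * r₂)) (suc (4 * r₁)) fits
  open Blocks r₁ r₂ blockVertex reservoirVertex
    blockVertex-injective reservoirVertex-injective reservoirVertex-fresh bad bad⇒Bad

n<2^n : ∀ n → n < 2 ^ n
n<2^n zero    = s≤s z≤n
n<2^n (suc n) = begin
  2 + n             ≤⟨ s≤s (n<2^n n) ⟩
  1 + 2 ^ n         ≤⟨ +-monoˡ-≤ (2 ^ n) (m^n>0 2 n) ⟩
  2 ^ n + 2 ^ n     ≡⟨ cong (2 ^ n +_) (sym (+-identityʳ _)) ⟩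
  2 ^ suc n         ∎
  where open ≤-Reasoning

-- The parameter t is about √(log₂ n) / 32.  The definition is abstract because
-- comparing unfolded terms 2 ^ scale (suc t) is exponential in 1024.
abstract
  scale : ℕ → ℕ
  scale t = t * t * 1024

  scale-def : ∀ t → scale t ≡ t * t * 1024
  scale-def t = refl

scale-mono : ∀ {s t} → s ≤ t → scale s ≤ scale t
scale-mono {s} {t} s≤t rewrite scale-def s | scale-def t = *-monoˡ-≤ 1024 (*-mono-≤ s≤t s≤t)

bracket : ∀ n → 1 ≤ n → ∃[ t ] 2 ^ scale t ≤ n × n < 2 ^ scale (suc t)
bracket n 1≤n = search n (<-≤-trans (n<2^n n) (^-monoʳ-≤ 2 n≤scale))
  where
  n≤scale : n ≤ scale n
  n≤scale = ≤-trans (≤-trans (m≤n*m n n {{>-nonZero 1≤n}}) (m≤m*n (n * n) 1024)) (≤-reflexive (sym (scale-def n)))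
  search : ∀ k → n < 2 ^ scale k → ∃[ t ] 2 ^ scale t ≤ n × n < 2 ^ scale (suc t)
  search zero    n<1 = ⊥-elim (<-irrefl refl (≤-trans (≤-trans n<1 (≤-reflexive (cong (2 ^_) (scale-def 0)))) 1≤n))
  search (suc k) n<  with 2 ^ scale k ≤? n
  ... | yes ≤n = k , ≤n , n<
  ... | no  ≰n = search k (≰⇒> ≰n)

-- `x` stands for (t + 1)², so that `x * 1024` is `scale (suc t)`. The 13 comes from 4 · 1024 + 15 =
-- 4111 ≤ 2^13.
residual-bound : ∀ t x → t ≤ x → 1 ≤ x → x ≤ 2 ^ (t + t) → suc (4 * (x * 1024 + (t + 2))) + 2 ≤ 2 ^ (t + t + 13)
residual-bound t x t≤x 1≤x x≤ = begin
  suc (4 * (x * 1024 + (t + 2))) + 2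
    ≡⟨ expand (x * 1024) t ⟩
  4 * (x * 1024) + (4 * t + 11)
    ≤⟨ +-monoʳ-≤ (4 * (x * 1024)) (+-mono-≤ (*-monoʳ-≤ 4 t≤x) (*-monoʳ-≤ 11 1≤x)) ⟩
  4 * (x * 1024) + (4 * x + 11 * x)
    ≡⟨ cong₂ _+_ (trans (sym (*-assoc 4 x 1024)) (trans (cong (_* 1024) (*-comm 4 x)) (*-assoc x 4 1024)))
                 (trans (sym (*-distribʳ-+ x 4 11)) (*-comm 15 x)) ⟩
  x * 4096 + x * 15
    ≡⟨ sym (*-distribˡ-+ x 4096 15) ⟩
  x * 4111
    ≤⟨ *-mono-≤ x≤ (≤ᵇ⇒≤ 4111 (2 ^ 13) _) ⟩
  2 ^ (t + t) * 2 ^ 13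
    ≡⟨ sym (^-distribˡ-+-* 2 (t + t) 13) ⟩
  2 ^ (t + t + 13) ∎
  where
  open ≤-Reasoning
  expand : ∀ x t → suc (4 * (x + (t + 2))) + 2 ≡ 4 * x + (4 * t + 11)
  expand = solve-∀

-- `r₁` matches the upper bound for n times 2^(t+2). The residual clique is at most 2^(2t+13), and
-- 2t + 13 + t + 2 ≤ 4t motivates `r₂` and the bound on `t`. A block then has 16t + 1 ≤ 17t
-- vertices, which allows at most 2^(289t²) graphs; with the factors t + 2 and k the blocks need at
-- most 2^(291t²) vertices, and 1024 leaves ample room. It is a square, so that its root 32 can be
-- used in the final comparison.
module _ (t : ℕ) (16≤t : 16 ≤ t) where

  private
    s = suc t
    r₁ = scale s + (t + 2)
    r₂ = 4 * t
    ss≤ : s * s ≤ 2 ^ (t + t)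
    ss≤ = ≤-trans (*-mono-≤ (n<2^n t) (n<2^n t)) (≤-reflexive (sym (^-distribˡ-+-* 2 t t)))

    residual≤ : suc (4 * r₁) + 2 ≤ 2 ^ (t + t + 13)
    residual≤ = subst (λ x → suc (4 * (x + (t + 2))) + 2 ≤ 2 ^ (t + t + 13)) (sym (scale-def s))
      (residual-bound t (s * s) (≤-trans (n≤1+n t) (m≤m*n s s)) (s≤s z≤n) ss≤)

    small₂ : (suc (4 * r₁) + 2) * 2 ^ (t + 2) ≤ 2 ^ r₂
    small₂ = begin
      (suc (4 * r₁) + 2) * 2 ^ (t + 2)   ≤⟨ *-monoˡ-≤ (2 ^ (t + 2)) residual≤ ⟩
      2 ^ (t + t + 13) * 2 ^ (t + 2)     ≡⟨ sym (^-distribˡ-+-* 2 (t + t + 13) (t + 2)) ⟩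
      2 ^ (t + t + 13 + (t + 2))         ≤⟨ ^-monoʳ-≤ 2 (begin
        t + t + 13 + (t + 2) ≡⟨ collect t ⟩
        15 + 3 * t           ≤⟨ +-monoˡ-≤ (3 * t) (≤-trans (n≤1+n 15) 16≤t) ⟩
        4 * t                ∎) ⟩
      2 ^ (4 * t) ∎
      where
      open ≤-Reasoning
      collect : ∀ t → t + t + 13 + (t + 2) ≡ 15 + 3 * t
      collect = solve-∀

    k : ℕ
    k = suc (4 * r₂)

    16t≤tt : 16 * t ≤ t * t
    16t≤tt = *-monoˡ-≤ t 16≤t

    k*k≤ : k * k ≤ t * t * 289
    k*k≤ = begin
      k * k                 ≤⟨ *-mono-≤ {k} {t * 17} {k} {t * 17} k≤ k≤ ⟩
      t * 17 * (t * 17)     ≡⟨ square t 17 ⟩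
      t * t * (17 * 17)     ∎
      where
      open ≤-Reasoning
      square : ∀ t c → t * c * (t * c) ≡ t * t * (c * c)
      square = solve-∀
      k≤ : k ≤ t * 17
      k≤ = begin
        suc (4 * (4 * t)) ≤⟨ +-monoˡ-≤ (4 * (4 * t)) (≤-trans (s≤s z≤n) 16≤t) ⟩
        t + 4 * (4 * t)   ≡⟨ seventeen t ⟩
        t * 17            ∎
        where
        seventeen : ∀ t → t + 4 * (4 * t) ≡ t * 17
        seventeen = solve-∀

    blocks≤ : length (tris k) * (t + 2) * k ≤ 2 ^ (t * t * 291)
    blocks≤ = begin
      length (tris k) * (t + 2) * k
        ≤⟨ *-mono-≤ (*-mono-≤ (≤-trans (length-tris≤ k) (^-monoʳ-≤ 2 k*k≤)) t+2≤) k≤ ⟩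
      2 ^ (t * t * 289) * 2 ^ (t * t) * 2 ^ (t * t)
        ≡⟨ trans (cong (_* 2 ^ (t * t)) (sym (^-distribˡ-+-* 2 (t * t * 289) (t * t)))) (sym (^-distribˡ-+-* 2 (t * t * 289 + t * t) (t * t))) ⟩
      2 ^ (t * t * 289 + t * t + t * t)
        ≡⟨ cong (2 ^_) (collect (t * t)) ⟩
      2 ^ (t * t * 291) ∎
      where
      open ≤-Reasoning
      collect : ∀ x → x * 289 + x + x ≡ x * 291
      collect x = trans (cong (λ z → x * 289 + z + z) (sym (*-identityʳ x)))
        (trans (cong (_+ x * 1) (sym (*-distribˡ-+ x 289 1))) (sym (*-distribˡ-+ x 290 1)))
      k≤ : k ≤ 2 ^ (t * t)
      k≤ = ≤-trans (≤-reflexive (cong suc (sixteen t))) (≤-trans (s≤s 16t≤tt) (n<2^n (t * t)))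
        where
        sixteen : ∀ t → 4 * (4 * t) ≡ 16 * t
        sixteen = solve-∀
      t+2≤ : t + 2 ≤ 2 ^ (t * t)
      t+2≤ = ≤-trans (≤-trans (+-monoʳ-≤ t (≤-trans (s≤s (s≤s z≤n)) 16≤t)) (≤-trans (m≤m+n (t + t) (14 * t)) (≤-reflexive (collect′ t))))
                     (≤-trans 16t≤tt (<⇒≤ (n<2^n (t * t))))
        where
        collect′ : ∀ t → t + t + 14 * t ≡ 16 * t
        collect′ = solve-∀

    fits : length (tris k) * (t + 2) * k + suc (4 * r₁) ≤ 2 ^ scale t
    fits = begin
      length (tris k) * (t + 2) * k + suc (4 * r₁)
        ≤⟨ +-mono-≤ (≤-trans blocks≤ (^-monoʳ-≤ 2 (*-monoʳ-≤ (t * t) (≤ᵇ⇒≤ 291 1023 _)))) reservoir≤ ⟩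
      2 ^ (t * t * 1023) + 2 ^ (t * t * 1023)
        ≡⟨ cong (2 ^ (t * t * 1023) +_) (sym (+-identityʳ _)) ⟩
      2 ^ suc (t * t * 1023)
        ≤⟨ ^-monoʳ-≤ 2 (≤-trans (+-monoˡ-≤ (t * t * 1023) (*-mono-≤ 1≤t 1≤t))
             (≤-reflexive (trans (cong (_+ t * t * 1023) (sym (*-identityʳ (t * t)))) (trans (sym (*-distribˡ-+ (t * t) 1 1023)) (sym (scale-def t)))))) ⟩
      2 ^ scale t ∎
      where
      open ≤-Reasoning
      1≤t : 1 ≤ t
      1≤t = ≤-trans (s≤s z≤n) 16≤t
      reservoir≤ : suc (4 * r₁) ≤ 2 ^ (t * t * 1023)
      reservoir≤ = begin
        suc (4 * r₁)                        ≤⟨ m≤m+n _ 2 ⟩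
        suc (4 * r₁) + 2                    ≤⟨ m≤m*n _ (2 ^ (t + 2)) {{m^n≢0 2 (t + 2)}} ⟩
        (suc (4 * r₁) + 2) * 2 ^ (t + 2)    ≤⟨ small₂ ⟩
        2 ^ (4 * t)                         ≤⟨ ^-monoʳ-≤ 2 (≤-trans (*-monoˡ-≤ t (≤-trans (≤ᵇ⇒≤ 4 16 _) 16≤t)) (m≤m*n (t * t) 1023)) ⟩
        2 ^ (t * t * 1023)                  ∎

  bad-count-scale : ∀ {n} → 2 ^ scale t ≤ n → n < 2 ^ scale (suc t) →
    (L : List (Graph n)) → Unique L → All Bad L → 2 ^ t * length L ≤ 2 ^ (n C 2)
  bad-count-scale {n} lower upper L uniq allBad = *-cancelˡ-≤ 4 (begin
    4 * (2 ^ t * length L)        ≡⟨ trans (sym (*-assoc 4 (2 ^ t) _)) (cong (_* length L) (trans (*-comm 4 (2 ^ t)) (sym (^-distribˡ-+-* 2 t 2)))) ⟩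
    2 ^ (t + 2) * length L        ≤⟨ bad-count r₁ r₂ (t + 2) (≤-trans fits lower) small₁ small₂ L uniq allBad ⟩
    -- The two extra halvings in the exponent `t + 2` absorb the factor 3.
    3 * 2 ^ (n C 2)               ≤⟨ *-monoˡ-≤ (2 ^ (n C 2)) (n≤1+n 3) ⟩
    4 * 2 ^ (n C 2)               ∎)
    where
    open ≤-Reasoning
    small₁ : n * 2 ^ (t + 2) ≤ 2 ^ r₁
    small₁ = ≤-trans (*-monoˡ-≤ (2 ^ (t + 2)) (<⇒≤ upper)) (≤-reflexive (sym (^-distribˡ-+-* 2 (scale s) (t + 2))))

2^-cancel-≤ : ∀ {a b} → 2 ^ a ≤ 2 ^ b → a ≤ b
2^-cancel-≤ {a} {b} le with a ≤? b
... | yes p = p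
... | no ¬p = ⊥-elim (<⇒≱ (^-monoʳ-< 2 (s≤s (s≤s z≤n)) (≰⇒> ¬p)) le)

square-cancel-≤ : ∀ {a b} → a * a ≤ b * b → a ≤ b
square-cancel-≤ {a} {b} le with a ≤? b
... | yes p = p
... | no ¬p = ⊥-elim (<⇒≱ (*-mono-< (≰⇒> ¬p) (≰⇒> ¬p)) le)

-- From n < 2^(1024(t+1)²) follows √(log₂ n) < 32(t + 1) ≤ 64t, so a saving of 2^t exceeds 2^(√(log₂
-- n)/64). In the encoding, `u` over `v` is a rational lower bound for √(log₂ n).
withinBound : ∀ {n t m} → 1 ≤ t → n < 2 ^ scale (suc t) → 2 ^ t * m ≤ 2 ^ (n C 2) → WithinBound n m 1 64
withinBound {n} {t} {m} 1≤t upper bound u v u≤ = begin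
  2 ^ u * m ^ (64 * v)                  ≤⟨ *-monoˡ-≤ (m ^ (64 * v)) (^-monoʳ-≤ 2 u≤tv) ⟩
  2 ^ (t * (64 * v)) * m ^ (64 * v)     ≡⟨ cong (_* m ^ (64 * v)) (sym (^-*-assoc 2 t (64 * v))) ⟩
  (2 ^ t) ^ (64 * v) * m ^ (64 * v)     ≡⟨ sym (^-distribʳ-* (64 * v) (2 ^ t) m) ⟩
  (2 ^ t * m) ^ (64 * v)                ≤⟨ ^-monoˡ-≤ (64 * v) bound ⟩
  (2 ^ (n C 2)) ^ (64 * v)              ≡⟨ ^-*-assoc 2 (n C 2) (64 * v) ⟩
  2 ^ ((n C 2) * (64 * v))              ≡⟨ cong (2 ^_) (swap (n C 2) 64 v) ⟩
  2 ^ (64 * (n C 2) * v)                ∎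
  where
  open ≤-Reasoning
  swap : ∀ a b c → a * (b * c) ≡ b * a * c
  swap = solve-∀
  s = suc t
  u*u≤ : u * u ≤ s * v * 32 * (s * v * 32)
  u*u≤ = 2^-cancel-≤ (begin
    2 ^ (u * u)                       ≤⟨ u≤ ⟩
    n ^ (1 * 1 * (v * v))             ≤⟨ ^-monoˡ-≤ (1 * 1 * (v * v)) (<⇒≤ upper) ⟩
    (2 ^ scale s) ^ (1 * 1 * (v * v)) ≡⟨ ^-*-assoc 2 (scale s) (1 * 1 * (v * v)) ⟩
    2 ^ (scale s * (1 * 1 * (v * v))) ≡⟨ cong (2 ^_) (trans (cong (_* (1 * 1 * (v * v))) (scale-def s)) (square s v 32)) ⟩
    2 ^ (s * v * 32 * (s * v * 32))   ∎)
    where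
    square : ∀ s v c → s * s * (c * c) * (1 * 1 * (v * v)) ≡ s * v * c * (s * v * c)
    square = solve-∀
  u≤tv : u ≤ t * (64 * v)
  u≤tv = begin
    u                 ≤⟨ square-cancel-≤ u*u≤ ⟩
    s * v * 32        ≤⟨ *-monoˡ-≤ 32 (*-monoˡ-≤ v (+-monoˡ-≤ t 1≤t)) ⟩
    (t + t) * v * 32  ≡⟨ regroup t v 32 ⟩
    t * (64 * v)      ∎
    where
    regroup : ∀ t v c → (t + t) * v * c ≡ t * ((c + c) * v)
    regroup = solve-∀

bad-count-withinBound : ∀ t₀ → 16 ≤ t₀ → ∀ n → 2 ^ scale t₀ ≤ n → (L : List (Graph n)) → Unique L → All Bad L →
                        WithinBound n (length L) 1 64
bad-count-withinBound t₀ 16≤t₀ n n₀≤n L uniq allBad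
  with t , lower , upper ← bracket n (≤-trans (m^n>0 2 (scale t₀)) n₀≤n)
  = withinBound (≤-trans (s≤s z≤n) 16≤t) upper (bad-count-scale t 16≤t lower upper L uniq allBad)
  where
  16≤t : 16 ≤ t
  16≤t = ≤-trans 16≤t₀ (s≤s⁻¹ (≰⇒> λ s≤t₀ → <⇒≱ upper (≤-trans (^-monoʳ-≤ 2 (scale-mono s≤t₀)) n₀≤n)))

theorem1p6 : Σ ℕ λ p → Σ ℕ λ q → 1 ≤ p × 1 ≤ q × Σ ℕ λ n₀ →
    (n : ℕ) → n₀ ≤ n → (L : List (Graph n)) → Unique L → All Bad L →
    WithinBound n (length L) p q
theorem1p6 = 1 , 64 , s≤s z≤n , s≤s z≤n , 2 ^ scale 16 , bad-count-withinBound 16 ≤-refl
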